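{- For any $n\ge1$, $$C_n(-1,q)=\sum_{\pi\in\mathfrak{S}_n(321)}(-1)^{\mathsf{exc}\,\pi}q^{\mathsf{inv}\,\pi-\mathsf{exc}\,\pi}=\begin{cases}0,& n\text{ even},\\ (-q)^{(n-1)/2}C_{(n-1)/2}(q^2),& n\text{ odd},\end{cases}$$ and $$\sum_{\pi\in\mathfrak{D}_n(321)}(-1)^{\mathsf{exc}\,\pi}q^{\mathsf{inv}\,\pi}=\begin{cases}(-q)^{n/2}C_{n/2}(q^2),& n\text{ even},\\ 0,& n\text{ odd}.\end{cases}$$
   Context: $C_n(t,q)$ is defined by $\sum_{n\ge0}C_n(t,q)z^n=1/(1-c_1z/(1-c_2z/(1-c_3z/\cdots)))$ with $c_{2k-1}=q^{k-1}$, $c_{2k}=tq^{k-1}$; Carlitz's $q$-Catalan numbers are $C_n(q):=C_n(q,q^2)$. $\mathfrak{S}_n(321)$: permutations of $[n]$ avoiding $321$; $\mathfrak{D}_n(321)$: those among them with no fixed point. $\mathsf{exc}\,\pi=\#\{i:\pi(i)>i\}$, $\mathsf{inv}\,\pi=\#\{i<j:\pi(i)>\pi(j)\}$. -}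

module Defs where

open import Algebra.Bundles using (CommutativeRing)
open import Data.Fin.Base as Fin using (Fin; zero; suc; toℕ)
open import Data.Fin.Properties as Fin using (_≟_; _<?_; all?; any?)
open import Data.List.Base using (List; []; _∷_; length; filter; allFin; cartesianProduct; cartesianProductWith)
import Data.List.Base as List
open import Data.List.Membership.Propositional using (_∈_)
open import Data.List.Membership.Propositional.Properties using (∈-allFin; ∈-cartesianProductWith⁺)
open import Data.List.Relation.Unary.Any using (here)
open import Data.List.Relation.Unary.Unique.Propositional using (Unique)
import Data.List.Relation.Unary.Unique.Propositional.Properties as Unique
open import Data.List.Relation.Unary.All using ([])
open import Data.List.Relation.Unary.AllPairs using ([]; _∷_)
open import Data.Nat.Base as ℕ using (ℕ; zero; suc; _∸_; _≤_; z≤n; s≤s)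
import Data.Nat.Properties as ℕ
open import Data.Product.Base using (∃-syntax; _×_; _,_; proj₁; proj₂)
open import Data.Vec.Base using (Vec; []; _∷_; lookup; head)
import Data.Vec.Properties as Vec
open import Function.Base using (_∘_)
open import Function.Definitions using (Bijective)
open import Relation.Binary.PropositionalEquality as ≡ using (_≡_; _≢_)
open import Relation.Nullary using (¬_)
open import Relation.Nullary.Decidable using (Dec; map′; ¬?; _×-dec_; _→-dec_)

-- A permutation π of [n] is given by its one-line notation
-- π(1) … π(n), with [n] represented by Fin n (i.e. shifted to start
-- at 0, which affects none of the statistics below).

Word : ℕ → Set
Word n = Vec (Fin n) n

IsPermutation : ∀ {n} → Word n → Set
IsPermutation π = Bijective _≡_ _≡_ (lookup π)

Contains321 : ∀ {n} → Word n → Set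
Contains321 π = ∃[ i ] ∃[ j ] ∃[ k ]
  (i Fin.< j × j Fin.< k × lookup π j Fin.< lookup π i × lookup π k Fin.< lookup π j)

Avoids321 : ∀ {n} → Word n → Set
Avoids321 π = ¬ Contains321 π

FixedPointFree : ∀ {n} → Word n → Set
FixedPointFree π = ∀ i → lookup π i ≢ i

isPermutation? : ∀ {n} (π : Word n) → Dec (IsPermutation π)
isPermutation? π = injective? ×-dec surjective?
  where
  injective? = map′ (λ h {x} {y} → h x y) (λ h x y → h)
    (all? λ x → all? λ y → (lookup π x ≟ lookup π y) →-dec (x ≟ y))
  surjective? = map′
    (λ h y → proj₁ (h y) , λ { ≡.refl → proj₂ (h y) })
    (λ h y → proj₁ (h y) , proj₂ (h y) ≡.refl)
    (all? λ y → any? λ x → lookup π x ≟ y)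

avoids321? : ∀ {n} (π : Word n) → Dec (Avoids321 π)
avoids321? π = ¬? (any? λ i → any? λ j → any? λ k →
  (i <? j) ×-dec (j <? k) ×-dec (lookup π j <? lookup π i) ×-dec (lookup π k <? lookup π j))

fixedPointFree? : ∀ {n} (π : Word n) → Dec (FixedPointFree π)
fixedPointFree? π = all? λ i → ¬? (lookup π i ≟ i)

allWords : ∀ m n → List (Vec (Fin m) n)
allWords m zero    = [] ∷ []
allWords m (suc n) = cartesianProductWith _∷_ (allFin m) (allWords m n)

∈-allWords : ∀ {m n} (w : Vec (Fin m) n) → w ∈ allWords m n
∈-allWords []      = here ≡.refl
∈-allWords (x ∷ w) = ∈-cartesianProductWith⁺ _∷_ (∈-allFin x) (∈-allWords w)

allWords-unique : ∀ m n → Unique (allWords m n)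
allWords-unique m zero    = [] ∷ []
allWords-unique m (suc n) =
  Unique.cartesianProductWith⁺ _∷_ Vec.∷-injective (Unique.allFin⁺ m) (allWords-unique m n)

𝔖321 : ∀ n → List (Word n)
𝔖321 n = filter (λ π → isPermutation? π ×-dec avoids321? π) (allWords n n)

𝔇321 : ∀ n → List (Word n)
𝔇321 n = filter fixedPointFree? (𝔖321 n)

exc : ∀ {n} → Word n → ℕ
exc {n} π = length (filter (λ i → i <? lookup π i) (allFin n))

inv : ∀ {n} → Word n → ℕ
inv {n} π = length (filter
  (λ (i , j) → (i <? j) ×-dec (lookup π j <? lookup π i))
  (cartesianProduct (allFin n) (allFin n)))

-- interleave f g = f 0 , g 0 , f 1 , g 1 , …
interleave : ∀ {a} {A : Set a} → (ℕ → A) → (ℕ → A) → ℕ → A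
interleave f g zero    = f zero
interleave f g (suc n) = interleave g (f ∘ suc) n

module QCatalan {c ℓ} (R : CommutativeRing c ℓ) where

  open CommutativeRing R public hiding (zero)
  open import Algebra.Properties.Semiring.Exp semiring public using (_^_)
  open import Algebra.Properties.CommutativeMonoid.Sum +-commutativeMonoid
    using (sum; sum-syntax; sum-cong-≋)

  ∑ : ∀ {a} {A : Set a} → List A → (A → Carrier) → Carrier
  ∑ xs f = List.foldr _+_ 0# (List.map f xs)

  -- Formal power series in z, as sequences of coefficients.
  Series : Set c
  Series = ℕ → Carrier

  1ₛ : Series
  1ₛ zero    = 1#
  1ₛ (suc _) = 0#

  _·_ : Series → Series → Series
  (f · g) n = ∑[ i < suc n ] (f (toℕ i) * g (n ∸ toℕ i))

  -- The series 1 - a z f.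
  1-_z_ : Carrier → Series → Series
  (1- a z f) zero    = 1#
  (1- a z f) (suc n) = - (a * f n)

  -- The reciprocal g = 1 / f of a series with f₀ = 1 is determined by
  -- g₀ = 1 and gₙ₊₁ = - ∑_{i ≤ n} fᵢ₊₁ gₙ₋ᵢ; recipVec f n is the
  -- vector (gₙ , … , g₀).
  recipVec : Series → ∀ n → Vec Carrier (suc n)
  recipVec f zero    = 1# ∷ []
  recipVec f (suc n) =
    - (∑[ i < suc n ] (f (suc (toℕ i)) * lookup (recipVec f n) i)) ∷ recipVec f n

  1/_ : Series → Series
  (1/ f) n = head (recipVec f n)

  -- convergent N c = 1/(1 - c₀ z/(1 - c₁ z/(⋯/(1 - c_{N-1} z)))).
  convergent : ℕ → (ℕ → Carrier) → Series
  convergent zero    c = 1ₛ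
  convergent (suc N) c = 1/ (1- c 0 z convergent N (c ∘ suc))

  -- The infinite continued fraction 1/(1 - c₀ z/(1 - c₁ z/⋯)), i.e. the
  -- z-adic limit of the convergents: by convergent-stable below the
  -- coefficient of zⁿ no longer changes from the n-th convergent on.
  contFrac : (ℕ → Carrier) → Series
  contFrac c n = convergent n c n

  -- Indices start at 0 here: the j-th term is c_{j+1}, so that the even
  -- terms are c_{2k-1} = q^{k-1} and the odd ones c_{2k} = t q^{k-1}.
  catalanCoeff : Carrier → Carrier → ℕ → Carrier
  catalanCoeff t q = interleave (λ k → q ^ k) (λ k → t * q ^ k)

  C : ℕ → Carrier → Carrier → Carrier
  C n t q = contFrac (catalanCoeff t q) n

  Carlitz : ℕ → Carrier → Carrier
  Carlitz n q = C n q (q ^ 2)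

  private
    lookup-recipVec : ∀ f n (i : Fin (suc n)) →
                      lookup (recipVec f n) i ≡ (1/ f) (n ∸ toℕ i)
    lookup-recipVec f zero    zero    = ≡.refl
    lookup-recipVec f (suc n) zero    = ≡.refl
    lookup-recipVec f (suc n) (suc i) = lookup-recipVec f n i

    recipVec-cong : ∀ {f g} n → (∀ k → k ≤ n → f k ≈ g k) →
                    ∀ i → lookup (recipVec f n) i ≈ lookup (recipVec g n) i
    recipVec-cong zero    f≈g zero    = refl
    recipVec-cong (suc n) f≈g zero    = -‿cong (sum-cong-≋ λ i →
      *-cong (f≈g (suc (toℕ i)) (Fin.toℕ<n i))
             (recipVec-cong n (λ k k≤n → f≈g k (ℕ.m≤n⇒m≤1+n k≤n)) i))
    recipVec-cong (suc n) f≈g (suc i) =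
      recipVec-cong n (λ k k≤n → f≈g k (ℕ.m≤n⇒m≤1+n k≤n)) i

    1/-cong : ∀ {f g} n → (∀ k → k ≤ n → f k ≈ g k) → (1/ f) n ≈ (1/ g) n
    1/-cong {f} {g} n f≈g = trans (reflexive (≡.sym (lookup-recipVec f n zero)))
      (trans (recipVec-cong n f≈g zero) (reflexive (lookup-recipVec g n zero)))

  1/-inverse : ∀ f → f 0 ≈ 1# → ∀ n → (f · (1/ f)) n ≈ 1ₛ n
  1/-inverse f f₀≈1 zero    = trans (+-identityʳ _) (trans (*-identityʳ _) f₀≈1)
  1/-inverse f f₀≈1 (suc n) = trans
    (+-cong (trans (*-congʳ f₀≈1) (*-identityˡ _))
            (sum-cong-≋ λ i → *-congˡ {f (suc (toℕ i))} (reflexive (≡.sym (lookup-recipVec f n i)))))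
    (-‿inverseˡ _)

  convergent-stable : ∀ {n N M} c → n ≤ N → n ≤ M →
                      convergent N c n ≈ convergent M c n
  convergent-stable {N = zero}  {zero}  c z≤n _   = refl
  convergent-stable {N = zero}  {suc M} c z≤n _   = refl
  convergent-stable {N = suc N} {zero}  c _   z≤n = refl
  convergent-stable {n} {suc N} {suc M} c n≤N n≤M = 1/-cong n λ
    { zero    _   → refl
    ; (suc k) k<n → -‿cong (*-congˡ (convergent-stable (c ∘ suc)
        (ℕ.≤-pred (ℕ.≤-trans k<n n≤N)) (ℕ.≤-pred (ℕ.≤-trans k<n n≤M))))
    }

  contFrac-unfold : ∀ c n → contFrac c n ≈ (1/ (1- c 0 z contFrac (c ∘ suc))) n
  contFrac-unfold c n = trans
    (convergent-stable {n} {n} {suc n} c ℕ.≤-refl (ℕ.n≤1+n n))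
    (1/-cong n λ
      { zero    _   → refl
      ; (suc k) k<n → -‿cong (*-congˡ (convergent-stable (c ∘ suc) (ℕ.<⇒≤ k<n) ℕ.≤-refl))
      })

{-# OPTIONS --safe #-}
-- Reading a 321-avoiding permutation from left to right, each letter is
-- either a new maximum or the least value not used so far.  Weighting by
-- x^fix s^exc q^(inv - exc), this gives a linear recursion for L n h, the
-- total weight of the completions with n letters left and h unused values
-- below the maximum.  It is solved by q-binomial sums of weighted Motzkin
-- path counts P n j, so that L n 0 = P n 0.
--
-- For s = t and x = 1 the Motzkin paths are the even contraction of the
-- continued fraction of C_n(t,q).  For t = -1 its odd contraction has no
-- level steps and equals, up to the index shift n ↦ n - 1, the path count for
-- s = -q and x = 0, which belongs to derangements weighted by (-1)^exc q^inv.
-- Both are thus Dyck path counts with up steps weighted -q q^(2h), which are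
-- (-q)^m times Carlitz numbers at q².
module Submission where

open import Defs
open import Algebra.Bundles using (CommutativeRing)
open import Data.Bool.Base using (Bool; true; false; if_then_else_)
open import Data.Empty using (⊥)
open import Data.Fin.Base as Fin using (Fin; zero; suc; toℕ; punchIn; punchOut)
import Data.Fin.Properties as Fin
open import Data.List.Base as List
  using (List; []; _∷_; _++_; length; filter; cartesianProduct; cartesianProductWith)
open import Data.List.Membership.Propositional using (_∈_)
open import Data.List.Membership.Propositional.Properties
  using (∈-allFin; ∈-cartesianProductWith⁺; ∈-map⁺; ∈-map⁻; ∈-filter⁺; ∈-filter⁻)
open import Data.List.Membership.Propositional.Properties.WithK using (unique∧set⇒bag)
open import Data.List.Properties using (map-tabulate; length-++; filter-++)
open import Data.List.Relation.Binary.BagAndSetEquality using (∼bag⇒↭)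
open import Data.List.Relation.Binary.Permutation.Propositional as ↭ using (_↭_)
open import Data.List.Relation.Unary.All using ([])
open import Data.List.Relation.Unary.AllPairs using ([]; _∷_)
open import Data.List.Relation.Unary.Any using (here)
open import Data.List.Relation.Unary.Unique.Propositional using (Unique)
import Data.List.Relation.Unary.Unique.Propositional.Properties as Unique
open import Data.Nat.Base as ℕ using (ℕ; zero; suc; _≤_; _<_; _∸_; _/_; z≤n; s≤s; s≤s⁻¹)
open import Data.Nat.Divisibility using (_∣_; divides)
open import Data.Nat.DivMod using (m*n/n≡m)
open import Data.Nat.Induction using (<-rec)
import Data.Nat.Properties as ℕ
open import Data.Product.Base using (∃-syntax; _×_; _,_; proj₁; proj₂)
open import Data.Sum.Base using (inj₁; inj₂)
open import Data.Vec.Base as Vec using (lookup)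
import Data.Vec.Properties as Vec
open import Function.Base using (_∘_; _∋_; id)
open import Function.Bundles using (_⇔_; mk⇔; Equivalence)
open import Relation.Binary.PropositionalEquality as ≡ using (_≡_; _≢_; _≗_)
open import Relation.Nullary using (¬_; Dec; yes; no; contradiction)
open import Relation.Nullary.Decidable using (does; _×-dec_; does-⇔; dec-true; dec-false)
open import Relation.Unary using (Pred; Decidable)

-- Permutations

private
  variable
    m n h k : ℕ

infixr 5 _◂_
-- The inverse of deleting the first letter and standardising: `punchIn v` is the increasing map
-- onto the values other than `v`.
_◂_ : Fin (suc n) → (Fin n → Fin n) → Fin (suc n) → Fin (suc n)
(v ◂ f) zero    = v
(v ◂ f) (suc i) = punchIn v (f i)

toℕ-punchIn-< : (v : Fin (suc n)) (a : Fin n) → toℕ a < toℕ v → toℕ (punchIn v a) ≡ toℕ a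
toℕ-punchIn-< (suc v) zero    _         = ≡.refl
toℕ-punchIn-< (suc v) (suc a) (s≤s a<v) = ≡.cong suc (toℕ-punchIn-< v a a<v)

toℕ-punchIn-≥ : (v : Fin (suc n)) (a : Fin n) → toℕ v ≤ toℕ a → toℕ (punchIn v a) ≡ suc (toℕ a)
toℕ-punchIn-≥ zero    a       _         = ≡.refl
toℕ-punchIn-≥ (suc v) (suc a) (s≤s v≤a) = ≡.cong suc (toℕ-punchIn-≥ v a v≤a)

punchIn-mono-< : (v : Fin (suc n)) {a b : Fin n} → a Fin.< b → punchIn v a Fin.< punchIn v b
punchIn-mono-< zero    a<b                       = s≤s a<b
punchIn-mono-< (suc v) {zero}  {suc b} _         = s≤s z≤n
punchIn-mono-< (suc v) {suc a} {suc b} (s≤s a<b) = s≤s (punchIn-mono-< v a<b)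

punchIn-cancel-< : (v : Fin (suc n)) {a b : Fin n} → punchIn v a Fin.< punchIn v b → a Fin.< b
punchIn-cancel-< zero    (s≤s a<b)                 = a<b
punchIn-cancel-< (suc v) {zero}  {suc b} _         = s≤s z≤n
punchIn-cancel-< (suc v) {suc a} {suc b} (s≤s a<b) = s≤s (punchIn-cancel-< v a<b)

punchIn-<-pivot : (v : Fin (suc n)) {a : Fin n} → punchIn v a Fin.< v → toℕ a < toℕ v
punchIn-<-pivot (suc v) {zero}  _         = s≤s z≤n
punchIn-<-pivot (suc v) {suc a} (s≤s a<v) = s≤s (punchIn-<-pivot v a<v)

pivot->-punchIn : (v : Fin (suc n)) {a : Fin n} → toℕ a < toℕ v → punchIn v a Fin.< v
pivot->-punchIn v {a} a<v = ≡.subst (_< toℕ v) (≡.sym (toℕ-punchIn-< v a a<v)) a<v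

≤-punchIn : (v : Fin (suc n)) (a : Fin n) → toℕ a ≤ toℕ (punchIn v a)
≤-punchIn zero    a       = ℕ.n≤1+n _
≤-punchIn (suc v) zero    = z≤n
≤-punchIn (suc v) (suc a) = s≤s (≤-punchIn v a)

infixr 5 _∷_

-- Lehmer codes: each letter is its rank among the values not used before it.
data Code : ℕ → Set where
  []  : Code 0
  _∷_ : Fin (suc n) → Code n → Code (suc n)

perm : Code n → Fin n → Fin n
perm (v ∷ c) = v ◂ perm c

decode : Code n → Word n
decode c = Vec.tabulate (perm c)

lookup-decode : (c : Code n) → lookup (decode c) ≗ perm c
lookup-decode c = Vec.lookup∘tabulate (perm c)

∷-injectiveᶜ : ∀ {v w : Fin (suc n)} {c d : Code n} → (Code (suc n) ∋ v ∷ c) ≡ w ∷ d → v ≡ w × c ≡ d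
∷-injectiveᶜ ≡.refl = ≡.refl , ≡.refl

codes : ∀ n → List (Code n)
codes zero    = [] ∷ []
codes (suc n) = cartesianProductWith _∷_ (List.allFin (suc n)) (codes n)

∈-codes : (c : Code n) → c ∈ codes n
∈-codes []      = here ≡.refl
∈-codes (v ∷ c) = ∈-cartesianProductWith⁺ _∷_ (∈-allFin v) (∈-codes c)

codes-unique : ∀ n → Unique (codes n)
codes-unique zero    = [] ∷ []
codes-unique (suc n) = Unique.cartesianProductWith⁺ _∷_ ∷-injectiveᶜ (Unique.allFin⁺ (suc n)) (codes-unique n)

perm-injective : (c d : Code n) → perm c ≗ perm d → c ≡ d
perm-injective []      []      _  = ≡.refl
perm-injective (v ∷ c) (w ∷ d) eq with ≡.refl ← eq zero =
  ≡.cong (v ∷_) (perm-injective c d (λ i → Fin.punchIn-injective v _ _ (eq (suc i))))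

decode-injective : {c d : Code n} → decode c ≡ decode d → c ≡ d
decode-injective {c = c} {d} eq = perm-injective c d λ i →
  ≡.trans (≡.sym (lookup-decode c i)) (≡.trans (≡.cong (λ π → lookup π i) eq) (lookup-decode d i))

perm-cancel : (c : Code n) → ∀ i j → perm c i ≡ perm c j → i ≡ j
perm-cancel (v ∷ c) zero    zero    _  = ≡.refl
perm-cancel (v ∷ c) zero    (suc j) eq = contradiction (≡.sym eq) (Fin.punchInᵢ≢i v _)
perm-cancel (v ∷ c) (suc i) zero    eq = contradiction eq (Fin.punchInᵢ≢i v _)
perm-cancel (v ∷ c) (suc i) (suc j) eq = ≡.cong suc (perm-cancel c i j (Fin.punchIn-injective v _ _ eq))

perm-surjective : (c : Code n) → ∀ y → ∃[ i ] perm c i ≡ y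
perm-surjective (v ∷ c) y with v Fin.≟ y
... | yes v≡y = zero , v≡y
... | no  v≢y with i , eq ← perm-surjective c (punchOut v≢y) =
  suc i , ≡.trans (≡.cong (punchIn v) eq) (Fin.punchIn-punchOut v≢y)

-- `punchOut` standardises the letters after the first and keeps them distinct, so the recursion
-- applies to them.
encode : (f : Fin n → Fin n) → (∀ i j → f i ≡ f j → i ≡ j) → ∃[ c ] perm c ≗ f
encode {zero}  f inj = [] , λ ()
encode {suc n} f inj = f zero ∷ proj₁ rec , λ
  { zero    → ≡.refl
  ; (suc i) → ≡.trans (≡.cong (punchIn (f zero)) (proj₂ rec i)) (Fin.punchIn-punchOut (f₀≢ i))
  }
  where
  f₀≢ : ∀ i → f zero ≢ f (suc i)
  f₀≢ i eq = Fin.0≢1+n (inj _ _ eq)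
  rec = encode (λ i → punchOut (f₀≢ i)) λ i j eq →
    Fin.suc-injective (inj _ _ (Fin.punchOut-injective (f₀≢ i) (f₀≢ j) eq))

decode-isPermutation : (c : Code n) → IsPermutation (decode c)
decode-isPermutation c =
  (λ {i} {j} eq → perm-cancel c i j (≡.trans (≡.sym (lookup-decode c i)) (≡.trans eq (lookup-decode c j)))) ,
  λ y → proj₁ (perm-surjective c y) , λ { ≡.refl → ≡.trans (lookup-decode c _) (proj₂ (perm-surjective c y)) }

isPermutation⇒decode : (π : Word n) → IsPermutation π → ∃[ c ] decode c ≡ π
isPermutation⇒decode π (inj , _) with c , eq ← encode (lookup π) (λ i j → inj) =
  c , ≡.trans (Vec.tabulate-cong eq) (Vec.tabulate∘lookup π)

-- Both lists are duplicate-free with the same members, hence equal up to order. Sums can thus run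
-- over codes, which recurse on the first letter.
𝔖321↭codes : ∀ n → 𝔖321 n ↭ filter avoids321? (List.map decode (codes n))
𝔖321↭codes n = ∼bag⇒↭ (unique∧set⇒bag
  (Unique.filter⁺ _ (allWords-unique n n))
  (Unique.filter⁺ avoids321? (Unique.map⁺ decode-injective (codes-unique n)))
  (mk⇔ to from))
  where
  to : ∀ {π} → π ∈ 𝔖321 n → π ∈ filter avoids321? (List.map decode (codes n))
  to {π} π∈ with _ , isPerm , avoids ← ∈-filter⁻ (λ π → isPermutation? π ×-dec avoids321? π) {xs = allWords n n} π∈
        with c , ≡.refl ← isPermutation⇒decode π isPerm = ∈-filter⁺ avoids321? (∈-map⁺ decode (∈-codes c)) avoids
  from : ∀ {π} → π ∈ filter avoids321? (List.map decode (codes n)) → π ∈ 𝔖321 n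
  from π∈ with π∈′ , avoids ← ∈-filter⁻ avoids321? {xs = List.map decode (codes n)} π∈
          with c , _ , ≡.refl ← ∈-map⁻ decode π∈′ = ∈-filter⁺ _ (∈-allWords _) (decode-isPermutation c , avoids)

-- Deleting the first letter v of a 321-avoiding permutation and
-- standardising leaves a 321-avoiding permutation in which the values
-- below v occur in increasing order, i.e. are not the top of an inversion.
record Admissible (h : ℕ) (f : Fin n → Fin m) : Set where
  field
    avoids : ∀ i j k → i Fin.< j → j Fin.< k → f j Fin.< f i → f k Fin.< f j → ⊥
    tops   : ∀ i j → i Fin.< j → f j Fin.< f i → h ≤ toℕ (f i)

open Admissible

module _ {f : Fin n → Fin n} where

  -- A 321 headed by `v` would need an inversion with top below `v`, which `tops` excludes for `f`.
  -- Every inversion top is at least `v`, hence at least `h`.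
  Admissible-max⁺ : ∀ {v} → Admissible (toℕ v) f → h ≤ toℕ v → Admissible h (v ◂ f)
  Admissible-max⁺ {v = v} a h≤v .avoids zero (suc j) (suc k) _ (s≤s j<k) fj<v fk<fj =
    ℕ.<⇒≱ (punchIn-<-pivot v fj<v) (a .tops j k j<k (punchIn-cancel-< v fk<fj))
  Admissible-max⁺ {v = v} a h≤v .avoids (suc i) (suc j) (suc k) (s≤s i<j) (s≤s j<k) fj<fi fk<fj =
    a .avoids i j k i<j j<k (punchIn-cancel-< v fj<fi) (punchIn-cancel-< v fk<fj)
  Admissible-max⁺ a h≤v .tops zero j _ _ = h≤v
  Admissible-max⁺ {v = v} a h≤v .tops (suc i) (suc j) (s≤s i<j) fj<fi =
    ℕ.≤-trans h≤v (ℕ.≤-trans (a .tops i j i<j (punchIn-cancel-< v fj<fi)) (≤-punchIn v (f i)))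

  -- An inversion of `f` with top below `v` would extend to a 321 headed by `v`.
  Admissible-max⁻ : ∀ {v} → Admissible h (v ◂ f) → Admissible (toℕ v) f
  Admissible-max⁻ {v = v} a .avoids i j k i<j j<k fj<fi fk<fj =
    a .avoids (suc i) (suc j) (suc k) (s≤s i<j) (s≤s j<k) (punchIn-mono-< v fj<fi) (punchIn-mono-< v fk<fj)
  Admissible-max⁻ {v = v} a .tops i j i<j fj<fi = ℕ.≮⇒≥ λ fi<v →
    a .avoids zero (suc i) (suc j) (s≤s z≤n) (s≤s i<j) (pivot->-punchIn v fi<v) (punchIn-mono-< v fj<fi)

  -- The least value in first place starts no inversion; it only raises the other values, and the
  -- threshold with them, by one.
  Admissible-min⁺ : Admissible h f → Admissible (suc h) (zero ◂ f)
  Admissible-min⁺ a .avoids (suc i) (suc j) (suc k) (s≤s i<j) (s≤s j<k) (s≤s fj<fi) (s≤s fk<fj) =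
    a .avoids i j k i<j j<k fj<fi fk<fj
  Admissible-min⁺ a .tops (suc i) (suc j) (s≤s i<j) (s≤s fj<fi) = s≤s (a .tops i j i<j fj<fi)

  Admissible-min⁻ : Admissible (suc h) (zero ◂ f) → Admissible h f
  Admissible-min⁻ a .avoids i j k i<j j<k fj<fi fk<fj =
    a .avoids (suc i) (suc j) (suc k) (s≤s i<j) (s≤s j<k) (s≤s fj<fi) (s≤s fk<fj)
  Admissible-min⁻ a .tops i j i<j fj<fi = s≤s⁻¹ (a .tops (suc i) (suc j) (s≤s i<j) (s≤s fj<fi))

-- The value 0 comes after a nonzero first letter and makes it the top of an inversion.
Admissible-first : ∀ {v} {c : Code n} → Admissible h (perm (suc v ∷ c)) → h ≤ suc (toℕ v)
Admissible-first {n = suc n} {v = v} {c} a with i , eq ← perm-surjective c zero =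
  a .tops zero (suc i) (s≤s z≤n) (≡.subst (λ y → punchIn (suc v) y Fin.< suc v) (≡.sym eq) (s≤s z≤n))

-- Values below `h` occur in increasing order, so all smaller values precede such a letter.
perm-low : (c : Code n) → Admissible h (perm c) → ∀ i → toℕ (perm c i) < h → toℕ (perm c i) ≤ toℕ i
perm-low (zero  ∷ c) a zero _   = z≤n
perm-low (suc v ∷ c) a zero v<h = contradiction (Admissible-first {c = c} a) (ℕ.<⇒≱ v<h)
perm-low {h = suc h} (zero ∷ c) a (suc i) (s≤s fi<h) = s≤s (perm-low c (Admissible-min⁻ a) i fi<h)
perm-low {h = h} (suc v ∷ c) a (suc i) fi<h = ℕ.≤-trans
  (ℕ.≤-reflexive (toℕ-punchIn-< (suc v) (perm c i) fi<v))
  (ℕ.m≤n⇒m≤1+n (perm-low c (Admissible-max⁻ a) i fi<v))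
  where
  fi<v : toℕ (perm c i) < suc (toℕ v)
  fi<v = punchIn-<-pivot (suc v) (ℕ.<-≤-trans fi<h (Admissible-first {c = c} a))

-- Counting

bit : Bool → ℕ
bit b = if b then 1 else 0

# : (Fin n → Bool) → ℕ
# {zero}  p = 0
# {suc n} p = bit (p zero) ℕ.+ # (p ∘ suc)

#-cong : {p r : Fin n → Bool} → p ≗ r → # p ≡ # r
#-cong {zero}  eq = ≡.refl
#-cong {suc n} eq = ≡.cong₂ ℕ._+_ (≡.cong bit (eq zero)) (#-cong (eq ∘ suc))

#-false : {p : Fin n → Bool} → (∀ i → p i ≡ false) → # p ≡ 0
#-false {zero}  eq = ≡.refl
#-false {suc n} eq = ≡.cong₂ ℕ._+_ (≡.cong bit (eq zero)) (#-false (eq ∘ suc))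

#≡0⇒false : {p : Fin n → Bool} → # p ≡ 0 → ∀ i → p i ≡ false
#≡0⇒false {suc n} {p} eq i with p zero in eq₀
#≡0⇒false {suc n} eq zero    | false = eq₀
#≡0⇒false {suc n} eq (suc i) | false = #≡0⇒false eq i

length-filter-tabulate : ∀ {a ℓ} {A : Set a} {P : Pred A ℓ} (P? : Decidable P) (g : Fin n → A) →
  length (filter P? (List.tabulate g)) ≡ # (λ i → does (P? (g i)))
length-filter-tabulate {zero}  P? g = ≡.refl
length-filter-tabulate {suc n} P? g with does (P? (g zero))
... | true  = ≡.cong suc (length-filter-tabulate P? (g ∘ suc))
... | false = length-filter-tabulate P? (g ∘ suc)

∑# : (Fin m → Fin n → Bool) → ℕ
∑# {zero}  p = 0
∑# {suc m} p = # (p zero) ℕ.+ ∑# (p ∘ suc)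

∑#-cong : {p r : Fin m → Fin n → Bool} → (∀ i → p i ≗ r i) → ∑# p ≡ ∑# r
∑#-cong {zero}  eq = ≡.refl
∑#-cong {suc m} eq = ≡.cong₂ ℕ._+_ (#-cong (eq zero)) (∑#-cong (eq ∘ suc))

∑#-dropColumn : (p : Fin m → Fin (suc n) → Bool) → (∀ i → p i zero ≡ false) → ∑# p ≡ ∑# (λ i → p i ∘ suc)
∑#-dropColumn {zero}  p eq = ≡.refl
∑#-dropColumn {suc m} p eq = ≡.cong₂ ℕ._+_ (≡.cong (λ b → bit b ℕ.+ # (p zero ∘ suc)) (eq zero))
  (∑#-dropColumn (p ∘ suc) (eq ∘ suc))

length-filter-cartesianProduct : ∀ {a ℓ} {A B : Set a} {P : Pred (A × B) ℓ} (P? : Decidable P)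
  (g : Fin m → A) (g′ : Fin n → B) →
  length (filter P? (cartesianProduct (List.tabulate g) (List.tabulate g′))) ≡ ∑# (λ i j → does (P? (g i , g′ j)))
length-filter-cartesianProduct {m = zero}  P? g g′ = ≡.refl
length-filter-cartesianProduct {m = suc m} P? g g′ = begin
  length (filter P? (row ++ rest))
    ≡⟨ ≡.cong length (filter-++ P? row rest) ⟩
  length (filter P? row ++ filter P? rest)
    ≡⟨ length-++ (filter P? row) ⟩
  length (filter P? row) ℕ.+ length (filter P? rest)
    ≡⟨ ≡.cong₂ ℕ._+_ (≡.trans (≡.cong (length ∘ filter P?) (map-tabulate g′ (g zero ,_)))
                              (length-filter-tabulate P? (λ j → g zero , g′ j)))
                     (length-filter-cartesianProduct P? (g ∘ suc) g′) ⟩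
  ∑# (λ i j → does (P? (g i , g′ j))) ∎
  where
  open ≡.≡-Reasoning
  row  = List.map (g zero ,_) (List.tabulate g′)
  rest = cartesianProduct (List.tabulate (g ∘ suc)) (List.tabulate g′)

-- Values below h stand for those below an already deleted maximum: in the
-- full permutation they are neither excedances nor fixed points.

exc≥ : ℕ → (Fin n → Fin n) → ℕ
exc≥ h f = # (λ i → does ((h ℕ.≤? toℕ (f i)) ×-dec (i Fin.<? f i)))

fix≥ : ℕ → (Fin n → Fin n) → ℕ
fix≥ h f = # (λ i → does ((h ℕ.≤? toℕ (f i)) ×-dec (f i Fin.≟ i)))

invᶠ : (Fin n → Fin n) → ℕ
invᶠ f = ∑# (λ i j → does ((i Fin.<? j) ×-dec (f j Fin.<? f i)))

-- Statistics of decoded words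

exc-decode : (c : Code n) → exc (decode c) ≡ exc≥ 0 (perm c)
exc-decode c = ≡.trans (length-filter-tabulate (λ i → i Fin.<? lookup (decode c) i) id)
  (#-cong λ i → ≡.cong (λ y → does (i Fin.<? y)) (lookup-decode c i))

inv-decode : (c : Code n) → inv (decode c) ≡ invᶠ (perm c)
inv-decode c = ≡.trans (length-filter-cartesianProduct
  (λ (i , j) → (i Fin.<? j) ×-dec (lookup (decode c) j Fin.<? lookup (decode c) i)) id id) (∑#-cong λ i j →
  ≡.cong₂ (λ x y → does ((i Fin.<? j) ×-dec (y Fin.<? x))) (lookup-decode c i) (lookup-decode c j))

fix-decode : (c : Code n) → FixedPointFree (decode c) ⇔ (fix≥ 0 (perm c) ≡ 0)
fix-decode c = mk⇔
  (λ free → #-false λ i → dec-false (perm c i Fin.≟ i) (free i ∘ ≡.trans (lookup-decode c i)))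
  (λ eq i fixed → contradiction
    (≡.trans (≡.sym (#≡0⇒false eq i)) (dec-true (perm c i Fin.≟ i) (≡.trans (≡.sym (lookup-decode c i)) fixed)))
    λ ())

-- This holds because `perm c` is a bijection. A first letter below `k` counts one, and the later
-- ranks are compared with `k` lowered by one; a larger first letter does not affect the values
-- below `k`.
#-below : (c : Code n) → k ≤ n → # (λ j → does (toℕ (perm c j) ℕ.<? k)) ≡ k
#-below {k = zero}  []      _   = ≡.refl
#-below {k = k}     (v ∷ c) k≤n with toℕ v ℕ.<? k
#-below {k = suc k} (v ∷ c) (s≤s k≤n) | yes (s≤s v≤k) = ≡.cong₂ ℕ._+_
  (≡.cong bit (dec-true (toℕ v ℕ.<? suc k) (s≤s v≤k)))
  (≡.trans (#-cong λ j → does-⇔ (shift (perm c j)) (_ ℕ.<? suc k) (_ ℕ.<? k)) (#-below c k≤n))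
  where
  shift : ∀ a → (toℕ (punchIn v a) < suc k) ⇔ (toℕ a < k)
  shift a with ℕ.<-≤-connex (toℕ a) (toℕ v)
  ... | inj₁ a<v rewrite toℕ-punchIn-< v a a<v = mk⇔ (λ _ → ℕ.<-≤-trans a<v v≤k) ℕ.m<n⇒m<1+n
  ... | inj₂ v≤a rewrite toℕ-punchIn-≥ v a v≤a = mk⇔ s≤s⁻¹ s≤s
#-below {n = suc n} {k = k} (v ∷ c) k≤n | no v≮k = ≡.cong₂ ℕ._+_
  (≡.cong bit (dec-false (toℕ v ℕ.<? k) v≮k))
  (≡.trans (#-cong λ j → does-⇔ (keep (perm c j)) (_ ℕ.<? k) (_ ℕ.<? k))
           (#-below c (ℕ.≤-trans k≤v (s≤s⁻¹ (Fin.toℕ<n v)))))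
  where
  k≤v = ℕ.≮⇒≥ v≮k
  keep : ∀ a → (toℕ (punchIn v a) < k) ⇔ (toℕ a < k)
  keep a with ℕ.<-≤-connex (toℕ a) (toℕ v)
  ... | inj₁ a<v rewrite toℕ-punchIn-< v a a<v = mk⇔ id id
  ... | inj₂ v≤a rewrite toℕ-punchIn-≥ v a v≤a = mk⇔ (ℕ.<-trans (ℕ.n<1+n _)) λ a<k →
    contradiction (ℕ.≤-trans k≤v v≤a) (ℕ.<⇒≱ a<k)

-- The first letter is the top of one inversion for each smaller value, all of which come later.
-- Iterating, the inversion number is the sum of the Lehmer code.
inv-∷ : (v : Fin (suc n)) (c : Code n) → invᶠ (perm (v ∷ c)) ≡ toℕ v ℕ.+ invᶠ (perm c)
inv-∷ v c = ≡.cong₂ ℕ._+_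
  (≡.trans (#-cong λ j → does-⇔ (mk⇔ (punchIn-<-pivot v) (pivot->-punchIn v))
             (punchIn v (f j) Fin.<? v) (toℕ (f j) ℕ.<? toℕ v))
           (#-below c (s≤s⁻¹ (Fin.toℕ<n v))))
  -- No position precedes the first, so its column contains no inversion.
  (≡.trans (∑#-dropColumn (λ i j → does ((suc i Fin.<? j) ×-dec ((v ◂ f) j Fin.<? punchIn v (f i)))) (λ _ → ≡.refl))
           (∑#-cong λ i j → does-⇔
             (mk⇔ (λ (i<j , lt) → s≤s⁻¹ i<j , punchIn-cancel-< v lt)
                  (λ (i<j , lt) → s≤s i<j , punchIn-mono-< v lt))
             ((suc i Fin.<? suc j) ×-dec (punchIn v (f j) Fin.<? punchIn v (f i)))
             ((i Fin.<? j) ×-dec (f j Fin.<? f i))))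
  where f = perm c

-- Effect of the first letter on excedances and fixed points

module _ (c : Code n) {v : Fin (suc n)} (h≤v : h ≤ toℕ v) (a : Admissible (toℕ v) (perm c)) where

  private
    f = perm c

    low : ∀ i → toℕ (f i) < toℕ v → toℕ (punchIn v (f i)) ≤ toℕ i
    low i fi<v = ≡.subst (_≤ toℕ i) (≡.sym (toℕ-punchIn-< v (f i) fi<v)) (perm-low c a i fi<v)

  -- By `low`, a value below `v` is smaller than its position `suc i`, so it is neither an excedance
  -- nor a fixed point. A value from `v` on moves up by one together with its position. The same
  -- split gives `fix-max-tail`.
  exc-max-tail : # (λ i → does ((h ℕ.≤? toℕ (punchIn v (f i))) ×-dec (suc i Fin.<? punchIn v (f i))))
                 ≡ exc≥ (toℕ v) f
  exc-max-tail = #-cong λ i → does-⇔ (equiv i)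
    ((h ℕ.≤? toℕ (punchIn v (f i))) ×-dec (suc i Fin.<? punchIn v (f i)))
    ((toℕ v ℕ.≤? toℕ (f i)) ×-dec (i Fin.<? f i))
    where
    equiv : ∀ i → (h ≤ toℕ (punchIn v (f i)) × suc i Fin.< punchIn v (f i)) ⇔ (toℕ v ≤ toℕ (f i) × i Fin.< f i)
    equiv i with ℕ.<-≤-connex (toℕ (f i)) (toℕ v)
    ... | inj₁ fi<v = mk⇔
      (λ (_ , lt) → contradiction (ℕ.m≤n⇒m≤1+n (low i fi<v)) (ℕ.<⇒≱ lt))
      (λ (v≤fi , _) → contradiction v≤fi (ℕ.<⇒≱ fi<v))
    ... | inj₂ v≤fi rewrite toℕ-punchIn-≥ v (f i) v≤fi = mk⇔
      (λ (_ , lt) → v≤fi , s≤s⁻¹ lt)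
      (λ (_ , lt) → ℕ.m≤n⇒m≤1+n (ℕ.≤-trans h≤v v≤fi) , s≤s lt)

  fix-max-tail : # (λ i → does ((h ℕ.≤? toℕ (punchIn v (f i))) ×-dec (punchIn v (f i) Fin.≟ suc i)))
                 ≡ fix≥ (toℕ v) f
  fix-max-tail = #-cong λ i → does-⇔ (equiv i)
    ((h ℕ.≤? toℕ (punchIn v (f i))) ×-dec (punchIn v (f i) Fin.≟ suc i))
    ((toℕ v ℕ.≤? toℕ (f i)) ×-dec (f i Fin.≟ i))
    where
    equiv : ∀ i → (h ≤ toℕ (punchIn v (f i)) × punchIn v (f i) ≡ suc i) ⇔ (toℕ v ≤ toℕ (f i) × f i ≡ i)
    equiv i with ℕ.<-≤-connex (toℕ (f i)) (toℕ v)
    ... | inj₁ fi<v = mk⇔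
      (λ (_ , eq) → contradiction (≡.subst (λ y → toℕ y ≤ toℕ i) eq (low i fi<v)) ℕ.1+n≰n)
      (λ (v≤fi , _) → contradiction v≤fi (ℕ.<⇒≱ fi<v))
    ... | inj₂ v≤fi = mk⇔
      (λ (_ , eq) → v≤fi , Fin.toℕ-injective (ℕ.suc-injective (≡.trans (≡.sym ≥) (≡.cong toℕ eq))))
      (λ (_ , eq) → ≡.subst (h ≤_) (≡.sym ≥) (ℕ.m≤n⇒m≤1+n (ℕ.≤-trans h≤v v≤fi)) ,
                    Fin.toℕ-injective (≡.trans ≥ (≡.cong (suc ∘ toℕ) eq)))
      where ≥ = toℕ-punchIn-≥ v (f i) v≤fi

module _ (c : Code n) where

  private f = perm c

  -- At threshold 0 the letter 0 is itself a new maximum, standing at its own position.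
  exc-fixed : Admissible 0 f → exc≥ 0 (perm (zero ∷ c)) ≡ exc≥ 0 f
  exc-fixed = exc-max-tail c {v = zero} z≤n

  fix-fixed : Admissible 0 f → fix≥ 0 (perm (zero ∷ c)) ≡ suc (fix≥ 0 f)
  fix-fixed = ≡.cong suc ∘ fix-max-tail c {v = zero} z≤n

  exc-max : ∀ {v} → h ≤ suc (toℕ v) → Admissible (suc (toℕ v)) f →
            exc≥ h (perm (suc v ∷ c)) ≡ suc (exc≥ (suc (toℕ v)) f)
  exc-max {h} {v} h≤v a = ≡.cong₂ ℕ._+_
    (≡.cong bit (dec-true ((h ℕ.≤? suc (toℕ v)) ×-dec (zero {n} Fin.<? suc v)) (h≤v , s≤s z≤n)))
    (exc-max-tail c {v = suc v} h≤v a)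

  fix-max : ∀ {v} → h ≤ suc (toℕ v) → Admissible (suc (toℕ v)) f →
            fix≥ h (perm (suc v ∷ c)) ≡ fix≥ (suc (toℕ v)) f
  fix-max {h} {v} h≤v a = ≡.cong₂ ℕ._+_
    (≡.cong bit (dec-false ((h ℕ.≤? suc (toℕ v)) ×-dec (suc v Fin.≟ zero)) (λ ())))
    (fix-max-tail c {v = suc v} h≤v a)

  -- The leading 0 lies below the threshold and does not count; the other values, their positions
  -- and the threshold all drop by one.
  exc-min : exc≥ (suc h) (perm (zero ∷ c)) ≡ exc≥ h f
  exc-min {h} = #-cong λ i → does-⇔
    (mk⇔ (λ (h≤ , lt) → s≤s⁻¹ h≤ , s≤s⁻¹ lt) (λ (h≤ , lt) → s≤s h≤ , s≤s lt))
    ((suc h ℕ.≤? suc (toℕ (f i))) ×-dec (suc i Fin.<? suc (f i))) ((h ℕ.≤? toℕ (f i)) ×-dec (i Fin.<? f i))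

  fix-min : fix≥ (suc h) (perm (zero ∷ c)) ≡ fix≥ h f
  fix-min {h} = #-cong λ i → does-⇔
    (mk⇔ (λ (h≤ , eq) → s≤s⁻¹ h≤ , Fin.suc-injective eq) (λ (h≤ , eq) → s≤s h≤ , ≡.cong suc eq))
    ((suc h ℕ.≤? suc (toℕ (f i))) ×-dec (suc (f i) Fin.≟ suc i)) ((h ℕ.≤? toℕ (f i)) ×-dec (f i Fin.≟ i))

-- Each excedance comes from a letter `suc v`, which starts at least one inversion. This makes the
-- truncated `inv ∸ exc` a true difference.
exc≤inv : (c : Code n) → Admissible h (perm c) → exc≥ h (perm c) ≤ invᶠ (perm c)
exc≤inv []                      a = z≤n
exc≤inv {h = zero}  (zero ∷ c)  a
  rewrite exc-fixed c (Admissible-max⁻ a) | inv-∷ zero c = exc≤inv c (Admissible-max⁻ a)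
exc≤inv {h = suc h} (zero ∷ c)  a rewrite exc-min c {h} | inv-∷ zero c = exc≤inv c (Admissible-min⁻ a)
exc≤inv {h = h}     (suc v ∷ c) a
  rewrite exc-max c {v = v} (Admissible-first {c = c} a) (Admissible-max⁻ a) | inv-∷ (suc v) c =
  s≤s (ℕ.≤-trans (exc≤inv c (Admissible-max⁻ a)) (ℕ.m≤n+m _ (toℕ v)))

-- At threshold 0 the condition `tops` is vacuous.
Avoids321⇔Admissible : (c : Code n) → Avoids321 (decode c) ⇔ Admissible 0 (perm c)
Avoids321⇔Admissible c = mk⇔
  (λ av → record
    { avoids = λ i j k i<j j<k lt lt′ → av (i , j , k , i<j , j<k ,
        ≡.subst₂ Fin._<_ (perm≗ j) (perm≗ i) lt , ≡.subst₂ Fin._<_ (perm≗ k) (perm≗ j) lt′)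
    ; tops   = λ _ _ _ _ → z≤n })
  (λ a (i , j , k , i<j , j<k , lt , lt′) → a .avoids i j k i<j j<k
    (≡.subst₂ Fin._<_ (lookup-decode c j) (lookup-decode c i) lt)
    (≡.subst₂ Fin._<_ (lookup-decode c k) (lookup-decode c j) lt′))
  where
  perm≗ : perm c ≗ lookup (decode c)
  perm≗ i = ≡.sym (lookup-decode c i)

-- Parity

-- Built from constructors, so that a path recursion over `double (suc n)` unfolds two steps by
-- computation.
double : ℕ → ℕ
double zero    = zero
double (suc n) = suc (suc (double n))

data Parity : ℕ → Set where
  even : ∀ k → Parity (double k)
  odd  : ∀ k → Parity (suc (double k))

parity : ∀ n → Parity n
parity zero = even 0
parity (suc n) with parity n
... | even k = odd k
... | odd k  = even (suc k)

interleave-even : ∀ {a} {A : Set a} (f g : ℕ → A) k → interleave f g (double k) ≡ f k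
interleave-even f g zero    = ≡.refl
interleave-even f g (suc k) = interleave-even (f ∘ suc) (g ∘ suc) k

interleave-odd : ∀ {a} {A : Set a} (f g : ℕ → A) k → interleave f g (suc (double k)) ≡ g k
interleave-odd f g zero    = ≡.refl
interleave-odd f g (suc k) = interleave-odd (f ∘ suc) (g ∘ suc) k

double≡*2 : ∀ k → double k ≡ k ℕ.* 2
double≡*2 zero    = ≡.refl
double≡*2 (suc k) = ≡.cong (2 ℕ.+_) (double≡*2 k)

double/2 : ∀ k → double k / 2 ≡ k
double/2 k = ≡.trans (≡.cong (_/ 2) (double≡*2 k)) (m*n/n≡m k 2)

2∣double : ∀ k → 2 ∣ double k
2∣double k = divides k (double≡*2 k)

2∤1+double : ∀ k → ¬ 2 ∣ suc (double k)
2∤1+double k (divides m eq) = absurd k m (≡.trans eq (≡.sym (double≡*2 m)))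
  where
  absurd : ∀ k m → suc (double k) ≢ double m
  absurd (suc k) (suc m) eq = absurd k m (ℕ.suc-injective (ℕ.suc-injective eq))

-- Weighted lattice paths

module Paths {ℓ₁ ℓ₂} (R : CommutativeRing ℓ₁ ℓ₂) where

  open QCatalan R
  open import Algebra.Properties.Ring ring using (-‿distribˡ-*; -1*x≈-x)
  open import Algebra.Properties.Semiring.Sum semiring
    using (sum; sum-syntax; sum-cong-≋; ∑-distrib-+; *-distribˡ-sum)
  open import Algebra.Solver.Ring.NaturalCoefficients.Default commutativeSemiring
    using (solve; _:=_; _:+_; _:*_; con)
  open import Relation.Binary.Reasoning.Setoid setoid

  -- Weighted Dyck path suffixes from height h: an up step from height i
  -- has weight c i, a down step weight 1.  B counts by the number of up
  -- steps, D by the total number of steps.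

  B : (ℕ → Carrier) → ℕ → ℕ → Carrier
  B c zero    _       = 1#
  B c (suc u) zero    = c 0 * B c u 1
  B c (suc u) (suc h) = B c (suc u) h + c (suc h) * B c u (suc (suc h))

  D : (ℕ → Carrier) → ℕ → ℕ → Carrier
  D c zero    zero    = 1#
  D c zero    (suc _) = 0#
  D c (suc n) zero    = c 0 * D c n 1
  D c (suc n) (suc h) = D c n h + c (suc h) * D c n (suc (suc h))

  -- Cut the path at its first visit to height 0. The part before it, with `i` up steps, stays above
  -- 0 until its final down step; lowered by one it carries the weights `c ∘ suc`.
  B-firstReturn : ∀ c u h → B c u (suc h) ≈ ∑[ i < suc u ] (B (c ∘ suc) (toℕ i) h * B c (u ∸ toℕ i) 0)
  B-firstReturn c zero    h       = sym (trans (+-identityʳ _) (*-identityʳ _))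
  B-firstReturn c (suc u) zero    = +-cong (sym (*-identityˡ _)) (begin
    c 1 * B c u 2
      ≈⟨ *-congˡ (B-firstReturn c u 1) ⟩
    c 1 * (∑[ i < suc u ] (B (c ∘ suc) (toℕ i) 1 * B c (u ∸ toℕ i) 0))
      ≈⟨ *-distribˡ-sum _ (λ (i : Fin (suc u)) → B (c ∘ suc) (toℕ i) 1 * B c (u ∸ toℕ i) 0) ⟩
    ∑[ i < suc u ] (c 1 * (B (c ∘ suc) (toℕ i) 1 * B c (u ∸ toℕ i) 0))
      ≈⟨ sum-cong-≋ (λ (i : Fin (suc u)) → *-assoc (c 1) (B (c ∘ suc) (toℕ i) 1) (B c (u ∸ toℕ i) 0)) ⟨
    ∑[ i < suc u ] (B (c ∘ suc) (suc (toℕ i)) 0 * B c (u ∸ toℕ i) 0) ∎)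
  B-firstReturn c (suc u) (suc h) = begin
    B c (suc u) (suc h) + c (2 ℕ.+ h) * B c u (3 ℕ.+ h)
      ≈⟨ +-cong (B-firstReturn c (suc u) h) (*-congˡ (B-firstReturn c u (2 ℕ.+ h))) ⟩
    (1# * B c (suc u) 0 + ∑[ i < suc u ] p i) + c (2 ℕ.+ h) * (∑[ i < suc u ] r i)
      ≈⟨ +-congˡ (*-distribˡ-sum _ r) ⟩
    (1# * B c (suc u) 0 + ∑[ i < suc u ] p i) + ∑[ i < suc u ] (c (2 ℕ.+ h) * r i)
      ≈⟨ +-assoc _ _ _ ⟩
    1# * B c (suc u) 0 + (∑[ i < suc u ] p i + ∑[ i < suc u ] (c (2 ℕ.+ h) * r i))
      ≈⟨ +-congˡ (∑-distrib-+ p (λ i → c (2 ℕ.+ h) * r i)) ⟨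
    1# * B c (suc u) 0 + ∑[ i < suc u ] (p i + c (2 ℕ.+ h) * r i)
      ≈⟨ +-congˡ (sum-cong-≋ {suc u} λ i →
           solve 4 (λ a b x y → x :* y :+ a :* (b :* y) := (x :+ a :* b) :* y) refl
             (c (2 ℕ.+ h)) (B (c ∘ suc) (toℕ i) (2 ℕ.+ h)) (B (c ∘ suc) (suc (toℕ i)) h) (B c (u ∸ toℕ i) 0)) ⟩
    1# * B c (suc u) 0 + ∑[ i < suc u ] (B (c ∘ suc) (suc (toℕ i)) (suc h) * B c (u ∸ toℕ i) 0) ∎
    where
    p r : Fin (suc u) → Carrier
    p i = B (c ∘ suc) (suc (toℕ i)) h * B c (u ∸ toℕ i) 0
    r i = B (c ∘ suc) (toℕ i) (2 ℕ.+ h) * B c (u ∸ toℕ i) 0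

  -- This is F = 1 + c₀ z G F read off coefficientwise, where G is the continued fraction of
  -- `c ∘ suc`.
  contFrac-suc : ∀ c n → contFrac c (suc n) ≈
    c 0 * (∑[ i < suc n ] (contFrac (c ∘ suc) (toℕ i) * contFrac c (n ∸ toℕ i)))
  contFrac-suc c n = begin
    contFrac c (suc n)
      ≈⟨ contFrac-unfold c (suc n) ⟩
    (1/ f) (suc n)
      ≈⟨ *-identityˡ _ ⟨
    1# * (1/ f) (suc n)
      ≈⟨ +-identityʳ _ ⟨
    1# * (1/ f) (suc n) + 0#
      -- Adding a sum and its negative completes the coefficient of `f · (1/ f)`, which vanishes in
      -- positive degree.
      ≈⟨ +-congˡ cancel ⟨
    1# * (1/ f) (suc n) + (∑[ i < suc n ] (f (suc (toℕ i)) * (1/ f) (n ∸ toℕ i)) + ∑[ i < suc n ] p i)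
      ≈⟨ +-assoc _ _ _ ⟨
    (f · (1/ f)) (suc n) + ∑[ i < suc n ] p i
      ≈⟨ +-congʳ (1/-inverse f refl (suc n)) ⟩
    0# + ∑[ i < suc n ] p i
      ≈⟨ +-identityˡ _ ⟩
    ∑[ i < suc n ] p i
      ≈⟨ sum-cong-≋ {suc n} (λ i → trans (*-assoc (c 0) (contFrac (c ∘ suc) (toℕ i)) ((1/ f) (n ∸ toℕ i)))
           (*-congˡ (*-congˡ (sym (contFrac-unfold c (n ∸ toℕ i)))))) ⟩
    ∑[ i < suc n ] (c 0 * (contFrac (c ∘ suc) (toℕ i) * contFrac c (n ∸ toℕ i)))
      ≈⟨ *-distribˡ-sum _ (λ (i : Fin (suc n)) → contFrac (c ∘ suc) (toℕ i) * contFrac c (n ∸ toℕ i)) ⟨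
    c 0 * (∑[ i < suc n ] (contFrac (c ∘ suc) (toℕ i) * contFrac c (n ∸ toℕ i))) ∎
    where
    f : Series
    f = 1- c 0 z contFrac (c ∘ suc)
    p p⁻ : Fin (suc n) → Carrier
    p i = c 0 * contFrac (c ∘ suc) (toℕ i) * (1/ f) (n ∸ toℕ i)
    p⁻ i = f (suc (toℕ i)) * (1/ f) (n ∸ toℕ i)
    sum-0 : ∀ k → ∑[ i < k ] 0# ≈ 0#
    sum-0 zero    = refl
    sum-0 (suc k) = trans (+-identityˡ _) (sum-0 k)
    cancel : ∑[ i < suc n ] p⁻ i + ∑[ i < suc n ] p i ≈ 0#
    cancel = begin
      ∑[ i < suc n ] p⁻ i + ∑[ i < suc n ] p i  ≈⟨ ∑-distrib-+ p⁻ p ⟨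
      ∑[ i < suc n ] (p⁻ i + p i)               ≈⟨ sum-cong-≋ {suc n} (λ i →
        trans (sym (distribʳ ((1/ f) (n ∸ toℕ i)) (f (suc (toℕ i))) (c 0 * contFrac (c ∘ suc) (toℕ i))))
          (trans (*-congʳ (-‿inverseˡ _)) (zeroˡ _))) ⟩
      ∑[ i < suc n ] 0#                        ≈⟨ sum-0 (suc n) ⟩
      0#                                       ∎

  -- Flajolet's path model of a continued fraction: after the forced first up step, `B-firstReturn`
  -- gives the same convolution as `contFrac-suc`. The induction covers all `c` at once because of
  -- the shifted weights.
  contFrac≈B : ∀ n c → contFrac c n ≈ B c n 0
  contFrac≈B = <-rec (λ n → ∀ c → contFrac c n ≈ B c n 0) λ
    { zero    _   c → refl
    ; (suc n) rec c → trans (contFrac-suc c n) (*-congˡ (trans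
        (sum-cong-≋ {suc n} λ i → *-cong (rec (Fin.toℕ<n i) (c ∘ suc)) (rec (s≤s (ℕ.m∸n≤m n (toℕ i))) c))
        (sym (B-firstReturn c n 0))))
    }

  -- Paths by total length

  D-tooHigh : ∀ c {n h} → n < h → D c n h ≈ 0#
  D-tooHigh c {zero}  {suc h} _         = refl
  D-tooHigh c {suc n} {suc h} (s≤s n<h) = begin
    D c n h + c (suc h) * D c n (2 ℕ.+ h)  ≈⟨ +-cong (D-tooHigh c n<h)
      (*-congˡ (D-tooHigh c (ℕ.m<n⇒m<1+n (ℕ.m<n⇒m<1+n n<h)))) ⟩
    0# + c (suc h) * 0#                    ≈⟨ trans (+-identityˡ _) (zeroʳ _) ⟩
    0#                                     ∎

  -- A path from height `h` to 0 with `u` up steps has `h + u` down steps, so its length determines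
  -- `u`.
  D≈B : ∀ c n u h → n ≡ h ℕ.+ double u → D c n h ≈ B c u h
  D≈B c zero    zero    zero    _  = refl
  D≈B c (suc n) (suc u) zero    eq = *-congˡ (D≈B c n u 1 (ℕ.suc-injective eq))
  D≈B c (suc n) zero    (suc h) eq = begin
    D c n h + c (suc h) * D c n (2 ℕ.+ h)  ≈⟨ +-cong (D≈B c n 0 h n≡h+0) (*-congˡ (D-tooHigh c n<2+h)) ⟩
    1# + c (suc h) * 0#                    ≈⟨ trans (+-congˡ (zeroʳ _)) (+-identityʳ _) ⟩
    1#                                     ∎
    where
    n≡h+0 = ℕ.suc-injective eq
    n<2+h : n < 2 ℕ.+ h
    n<2+h = s≤s (ℕ.m≤n⇒m≤1+n (ℕ.≤-reflexive (≡.trans n≡h+0 (ℕ.+-identityʳ h))))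
  D≈B c (suc n) (suc u) (suc h) eq = +-cong (D≈B c n (suc u) h n≡) (*-congˡ (D≈B c n u (2 ℕ.+ h)
    (≡.trans n≡ (≡.trans (ℕ.+-suc h _) (≡.cong suc (ℕ.+-suc h _))))))
    where n≡ = ℕ.suc-injective eq

  -- Each step changes the parity of the height.
  D-odd : ∀ c n k h → n ℕ.+ h ≡ suc (double k) → D c n h ≈ 0#
  D-odd c zero    k       (suc h) _  = refl
  D-odd c (suc n) k       zero    eq = trans (*-congˡ (D-odd c n k 1
    (≡.trans (ℕ.+-suc n 0) eq))) (zeroʳ _)
  D-odd c (suc n) zero    (suc h) eq with () ← ≡.trans (≡.sym (ℕ.+-suc n h)) (ℕ.suc-injective eq)
  D-odd c (suc n) (suc k) (suc h) eq = begin
    D c n h + c (suc h) * D c n (2 ℕ.+ h)  ≈⟨ +-cong (D-odd c n k h eq′)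
      (*-congˡ (D-odd c n (suc k) (2 ℕ.+ h)
        (≡.trans (≡.trans (ℕ.+-suc n _) (≡.cong suc (ℕ.+-suc n h))) (≡.cong (2 ℕ.+_) eq′)))) ⟩
    0# + c (suc h) * 0#                    ≈⟨ trans (+-identityˡ _) (zeroʳ _) ⟩
    0#                                     ∎
    where eq′ = ℕ.suc-injective (≡.trans (≡.sym (ℕ.+-suc n h)) (ℕ.suc-injective eq))

  -- Each of the `u` up steps contributes one factor `a`.
  B-scale : ∀ a {c d} → (∀ i → d i ≈ a * c i) → ∀ u h → B d u h ≈ a ^ u * B c u h
  B-scale a d≈ac zero    h       = sym (*-identityˡ _)
  B-scale a {c} d≈ac (suc u) zero    = trans (*-cong (d≈ac 0) (B-scale a d≈ac u 1))
    (solve 4 (λ a x y z → (a :* x) :* (y :* z) := (a :* y) :* (x :* z)) refl a (c 0) (a ^ u) _)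
  B-scale a {c} d≈ac (suc u) (suc h) = trans
    (+-cong (B-scale a d≈ac (suc u) h) (*-cong (d≈ac (suc h)) (B-scale a d≈ac u (2 ℕ.+ h))))
    (solve 5 (λ a x y z w → (a :* y) :* w :+ (a :* x) :* (y :* z) := (a :* y) :* (w :+ x :* z)) refl
      a (c (suc h)) (a ^ u) (B c u (2 ℕ.+ h)) (B c (suc u) h))

  contFrac-scale : ∀ a {c d} → (∀ i → d i ≈ a * c i) → ∀ m → D d (double m) 0 ≈ a ^ m * contFrac c m
  contFrac-scale a {c} {d} d≈ac m = begin
    D d (double m) 0       ≈⟨ D≈B d (double m) m 0 ≡.refl ⟩
    B d m 0                ≈⟨ B-scale a d≈ac m 0 ⟩
    a ^ m * B c m 0        ≈⟨ *-congˡ (contFrac≈B m c) ⟨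
    a ^ m * contFrac c m   ∎

  catalanCoeff-even : ∀ t q k → catalanCoeff t q (double k) ≈ q ^ k
  catalanCoeff-even t q k = reflexive (interleave-even (q ^_) (λ j → t * q ^ j) k)

  catalanCoeff-odd : ∀ t q k → catalanCoeff t q (suc (double k)) ≈ t * q ^ k
  catalanCoeff-odd t q k = reflexive (interleave-odd (q ^_) (λ j → t * q ^ j) k)

  ^-square-double : ∀ r k → (r ^ 2) ^ k ≈ r ^ double k
  ^-square-double r zero    = refl
  ^-square-double r (suc k) = trans (*-congˡ (^-square-double r k))
    (solve 2 (λ r x → (r :* (r :* con 1)) :* x := r :* (r :* x)) refl r (r ^ double k))

  -- At `t = r` and base `r ^ 2` the interleaved sequences merge into the powers of `r`: Carlitz
  -- numbers at `r` have the coefficients 1, r, r², ....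
  catalanCoeff-Carlitz : ∀ r j → catalanCoeff r (r ^ 2) j ≈ r ^ j
  catalanCoeff-Carlitz r j with parity j
  ... | even k = trans (catalanCoeff-even r (r ^ 2) k) (^-square-double r k)
  ... | odd k  = trans (catalanCoeff-odd r (r ^ 2) k) (*-congˡ (^-square-double r k))

  ^-square-product : ∀ q j → (q ^ 2) ^ j ≈ q ^ j * q ^ j
  ^-square-product q zero    = sym (*-identityˡ _)
  ^-square-product q (suc j) = trans (*-congˡ (^-square-product q j))
    (solve 2 (λ q x → (q :* (q :* con 1)) :* (x :* x) := (q :* x) :* (q :* x)) refl q (q ^ j))

  -- Motzkin paths and q-binomial sums

  module Motzkin (q s x : Carrier) where

    -- Motzkin path suffixes from height j with n steps. A down step weighs 1, an up step from
    -- height j weighs s q^(2j), and a level step weighs x at height 0 and q^j + s q^(j-1) at height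
    -- j > 0.
    P : ℕ → ℕ → Carrier
    P zero    zero    = 1#
    P zero    (suc _) = 0#
    P (suc n) zero    = x * P n 0 + s * P n 1
    P (suc n) (suc j) =
      (q ^ suc j + s * q ^ j) * P n (suc j) + s * (q ^ suc j * q ^ suc j) * P n (2 ℕ.+ j) + P n j

    U : (ℕ → Carrier) → ℕ → Carrier
    U f i = q ^ i * f i + s * (q ^ i * q ^ i) * f (suc i)

    -- In closed form 𝕊 h f = ∑ᵢ sⁱ q^(i(i-1)) [h choose i]_q f i; the
    -- definition and 𝕊-suc are the two q-Pascal rules.
    𝕊 : ℕ → (ℕ → Carrier) → Carrier
    𝕊 zero    f = f 0
    𝕊 (suc h) f = 𝕊 h (U f)

    V : (ℕ → Carrier) → ℕ → Carrier
    V f j = q ^ j * f (suc j)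

    𝕊-cong : ∀ h {f g} → (∀ i → f i ≈ g i) → 𝕊 h f ≈ 𝕊 h g
    𝕊-cong zero    f≈g = f≈g 0
    𝕊-cong (suc h) f≈g = 𝕊-cong h λ i → +-cong (*-congˡ (f≈g i)) (*-congˡ (f≈g (suc i)))

    𝕊-+ : ∀ h f g → 𝕊 h (λ i → f i + g i) ≈ 𝕊 h f + 𝕊 h g
    𝕊-+ zero    f g = refl
    𝕊-+ (suc h) f g = trans
      (𝕊-cong h λ i → solve 6 (λ a b f f′ g g′ →
        a :* (f :+ g) :+ b :* (f′ :+ g′) := (a :* f :+ b :* f′) :+ (a :* g :+ b :* g′)) refl
        (q ^ i) (s * (q ^ i * q ^ i)) (f i) (f (suc i)) (g i) (g (suc i)))
      (𝕊-+ h (U f) (U g))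

    𝕊-* : ∀ h a f → 𝕊 h (λ i → a * f i) ≈ a * 𝕊 h f
    𝕊-* zero    a f = refl
    𝕊-* (suc h) a f = trans
      (𝕊-cong h λ i → solve 5 (λ a b d f f′ → b :* (a :* f) :+ d :* (a :* f′) := a :* (b :* f :+ d :* f′)) refl
        a (q ^ i) (s * (q ^ i * q ^ i)) (f i) (f (suc i)))
      (𝕊-* h a (U f))

    𝕊-suc : ∀ h f → 𝕊 (suc h) f ≈ 𝕊 h f + s * q ^ h * 𝕊 h (V f)
    𝕊-suc zero    f = solve 3 (λ s a b →
      con 1 :* a :+ (s :* (con 1 :* con 1)) :* b := a :+ (s :* con 1) :* (con 1 :* b)) refl s (f 0) (f 1)
    𝕊-suc (suc h) f = begin
      𝕊 (suc h) (U f)                                   ≈⟨ 𝕊-suc h (U f) ⟩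
      -- `V` after `U` equals `q` times `U` after `V`.
      𝕊 h (U f) + s * q ^ h * 𝕊 h (V (U f))             ≈⟨ +-congˡ (*-congˡ (trans
        (𝕊-cong h λ i → solve 5 (λ q s a f₁ f₂ →
            a :* ((q :* a) :* f₁ :+ (s :* ((q :* a) :* (q :* a))) :* f₂)
            := q :* (a :* (a :* f₁) :+ (s :* (a :* a)) :* ((q :* a) :* f₂))) refl q s (q ^ i) (f (suc i)) (f (2 ℕ.+ i)))
        (𝕊-* h q (U (V f))))) ⟩
      𝕊 h (U f) + s * q ^ h * (q * 𝕊 h (U (V f)))       ≈⟨ +-congˡ (solve 4 (λ s a q y →
        (s :* a) :* (q :* y) := (s :* (q :* a)) :* y) refl s (q ^ h) q _) ⟩
      𝕊 h (U f) + s * q ^ suc h * 𝕊 h (U (V f))         ∎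

    -- The weights of `P` at positive heights are such that `V (P (suc n))` is pointwise `U (P n)`
    -- plus `q` times `U (V (P n))`. These two terms are the head and the rest of the sum in
    -- `L-tail`.
    𝕊-V-P : ∀ h n → 𝕊 h (V (P (suc n))) ≈ 𝕊 (suc h) (P n) + q * 𝕊 (suc h) (V (P n))
    𝕊-V-P h n = begin
      𝕊 h (V (P (suc n)))
        ≈⟨ 𝕊-cong h (λ j → solve 6 (λ q s a f₀ f₁ f₂ →
             a :* (((q :* a) :+ s :* a) :* f₁ :+ (s :* ((q :* a) :* (q :* a))) :* f₂ :+ f₀)
             := (a :* f₀ :+ (s :* (a :* a)) :* f₁) :+ q :* (a :* (a :* f₁) :+ (s :* (a :* a)) :* ((q :* a) :* f₂)))
             refl q s (q ^ j) (P n j) (P n (suc j)) (P n (2 ℕ.+ j))) ⟩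
      𝕊 h (λ j → U (P n) j + q * U (V (P n)) j)
        ≈⟨ 𝕊-+ h _ _ ⟩
      𝕊 h (U (P n)) + 𝕊 h (λ j → q * U (V (P n)) j)
        ≈⟨ +-congˡ (𝕊-* h q _) ⟩
      𝕊 (suc h) (P n) + q * 𝕊 (suc h) (V (P n)) ∎

    𝕊-V-P₀ : ∀ h → 𝕊 h (V (P 0)) ≈ 0#
    𝕊-V-P₀ h = begin
      𝕊 h (V (P 0))              ≈⟨ 𝕊-cong h (λ j → trans (zeroʳ _) (sym (zeroˡ _))) ⟩
      𝕊 h (λ j → 0# * 0#)        ≈⟨ 𝕊-* h 0# (λ _ → 0#) ⟩
      0# * 𝕊 h (λ _ → 0#)        ≈⟨ zeroˡ _ ⟩
      0#                         ∎

  -- Even contraction of the continued fraction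

  module _ (q t : Carrier) where
    open Motzkin q t 1# using (P)

    -- Two Dyck steps from an even height form one Motzkin step: up-up and down-down change the
    -- height by one, while up-down and down-up give the two summands of the level weight. Only
    -- up-down is possible at height 0.
    P≈D-catalan : ∀ n h → P n h ≈ D (catalanCoeff t q) (double n) (double h)
    P≈D-catalan zero    zero    = refl
    P≈D-catalan zero    (suc h) = refl
    P≈D-catalan (suc n) zero    = begin
      1# * P n 0 + t * P n 1
        ≈⟨ +-cong (*-congˡ (P≈D-catalan n 0)) (*-congˡ (P≈D-catalan n 1)) ⟩
      1# * d 0 + t * d 2
        ≈⟨ solve 3 (λ t a b → con 1 :* a :+ t :* b := con 1 :* (a :+ (t :* con 1) :* b)) refl t _ _ ⟩
      1# * (d 0 + t * 1# * d 2) ∎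
      where
      d = D (catalanCoeff t q) (double n)
    P≈D-catalan (suc n) (suc h) = begin
      (q ^ suc h + t * q ^ h) * P n (suc h) + t * (q ^ suc h * q ^ suc h) * P n (2 ℕ.+ h) + P n h
        ≈⟨ +-cong (+-cong (*-congˡ (P≈D-catalan n (suc h))) (*-congˡ (P≈D-catalan n (2 ℕ.+ h)))) (P≈D-catalan n h) ⟩
      (q ^ suc h + t * q ^ h) * d 2 + t * (q ^ suc h * q ^ suc h) * d 4 + d 0
        ≈⟨ solve 6 (λ t a b d₀ d₂ d₄ → (b :+ t :* a) :* d₂ :+ (t :* (b :* b)) :* d₄ :+ d₀
             := (d₀ :+ (t :* a) :* d₂) :+ b :* (d₂ :+ (t :* b) :* d₄)) refl t (q ^ h) (q ^ suc h) _ _ _ ⟩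
      (d 0 + t * q ^ h * d 2) + q ^ suc h * (d 2 + t * q ^ suc h * d 4)
        ≈⟨ +-cong (+-congˡ (*-congʳ (catalanCoeff-odd t q h)))
             (*-cong (catalanCoeff-even t q (suc h)) (+-congˡ (*-congʳ (catalanCoeff-odd t q (suc h))))) ⟨
      D c (double (suc n)) (double (suc h)) ∎
      where
      c = catalanCoeff t q
      d = λ i → D (catalanCoeff t q) (double n) (i ℕ.+ double h)

    C≈P : ∀ n → C n t q ≈ P n 0
    C≈P n = begin
      contFrac c n       ≈⟨ contFrac≈B n c ⟩
      B c n 0            ≈⟨ D≈B c (double n) n 0 ≡.refl ⟨
      D c (double n) 0   ≈⟨ P≈D-catalan n 0 ⟨
      P n 0              ∎
      where c = catalanCoeff t q

  -- Signed Dyck paths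

  module _ (q : Carrier) where

    signed : ℕ → Carrier
    signed h = - q * (q ^ h * q ^ h)

    -- At `s = - q` the level weights at positive heights cancel, and `x = 0` removes the level
    -- steps at height 0. The application has `s` of the form `- 1# * q`, hence the equation as a
    -- hypothesis.
    P-derangement : ∀ {s} → s ≈ - q → ∀ n h → Motzkin.P q s 0# n h ≈ D signed n h
    P-derangement s≈-q zero    zero    = refl
    P-derangement s≈-q zero    (suc h) = refl
    P-derangement s≈-q (suc n) zero    = trans (+-cong (zeroˡ _) (*-cong s≈-q (P-derangement s≈-q n 1)))
      (solve 2 (λ a b → con 0 :+ a :* b := (a :* (con 1 :* con 1)) :* b) refl (- q) _)
    P-derangement {s} s≈-q (suc n) (suc h) = begin
      (q ^ suc h + s * q ^ h) * P n (suc h) + s * (q ^ suc h * q ^ suc h) * P n (2 ℕ.+ h) + P n h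
        ≈⟨ +-cong (+-cong (trans (*-congʳ cancel) (zeroˡ _)) (*-cong (*-congʳ s≈-q) (P-derangement s≈-q n (2 ℕ.+ h))))
             (P-derangement s≈-q n h) ⟩
      0# + signed (suc h) * D signed n (2 ℕ.+ h) + D signed n h
        ≈⟨ trans (+-congʳ (+-identityˡ _)) (+-comm _ _) ⟩
      D signed (suc n) (suc h) ∎
      where
      P = Motzkin.P q s 0#
      cancel : q ^ suc h + s * q ^ h ≈ 0#
      cancel = trans (+-congˡ (trans (*-congʳ s≈-q) (sym (-‿distribˡ-* _ _)))) (-‿inverseʳ _)

    -- At t = -1 the consecutive coefficients c₂ₕ and c₂ₕ₊₁ cancel, so the
    -- contraction at odd heights has no level steps.
    D-catalan-odd : ∀ n h → D (catalanCoeff (- 1#) q) (suc (double n)) (suc (double h)) ≈ D signed n h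
    D-catalan-odd zero    zero    = trans (+-congˡ (zeroʳ _)) (+-identityʳ _)
    D-catalan-odd zero    (suc h) = trans (+-identityˡ _) (zeroʳ _)
    D-catalan-odd (suc n) zero    = begin
      1# * d 1 + - 1# * 1# * (d 1 + q * 1# * d 3)
        ≈⟨ solve 4 (λ m q d₁ d₃ → con 1 :* d₁ :+ (m :* con 1) :* (d₁ :+ (q :* con 1) :* d₃)
             := (con 1 :+ m) :* d₁ :+ ((m :* q) :* (con 1 :* con 1)) :* d₃) refl (- 1#) q _ _ ⟩
      (1# + - 1#) * d 1 + - 1# * q * (1# * 1#) * d 3
        ≈⟨ +-cong (trans (*-congʳ (-‿inverseʳ _)) (zeroˡ _)) (*-cong (*-congʳ (-1*x≈-x q)) (D-catalan-odd n 1)) ⟩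
      0# + signed 0 * D signed n 1
        ≈⟨ +-identityˡ _ ⟩
      D signed (suc n) 0 ∎
      where d = D (catalanCoeff (- 1#) q) (suc (double n))
    D-catalan-odd (suc n) (suc h) = begin
      (d 1 + c (double (suc h)) * d 3) + c (suc (double (suc h))) * (d 3 + c (double (2 ℕ.+ h)) * d 5)
        ≈⟨ +-cong (+-congˡ (*-congʳ (catalanCoeff-even (- 1#) q (suc h))))
             (*-cong (catalanCoeff-odd (- 1#) q (suc h))
                     (+-congˡ (*-congʳ (catalanCoeff-even (- 1#) q (2 ℕ.+ h))))) ⟩
      (d 1 + a * d 3) + - 1# * a * (d 3 + q * a * d 5)
        ≈⟨ solve 6 (λ m q a d₁ d₃ d₅ → (d₁ :+ a :* d₃) :+ (m :* a) :* (d₃ :+ (q :* a) :* d₅)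
             := (d₁ :+ ((con 1 :+ m) :* (a :* d₃))) :+ ((m :* q) :* (a :* a)) :* d₅) refl (- 1#) q a _ _ _ ⟩
      (d 1 + (1# + - 1#) * (a * d 3)) + - 1# * q * (a * a) * d 5
        ≈⟨ +-cong (+-cong (D-catalan-odd n h) (trans (*-congʳ (-‿inverseʳ _)) (zeroˡ _)))
             (*-cong (*-congʳ (-1*x≈-x q)) (D-catalan-odd n (2 ℕ.+ h))) ⟩
      (D signed n h + 0#) + signed (suc h) * D signed n (2 ℕ.+ h)
        ≈⟨ +-congʳ (+-identityʳ _) ⟩
      D signed (suc n) (suc h) ∎
      where
      c = catalanCoeff (- 1#) q
      a = q ^ suc h
      d = λ i → D (catalanCoeff (- 1#) q) (suc (double n)) (i ℕ.+ double h)

    -- The forced first up step, of weight 1, leads to height 1, where the odd contraction applies.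
    -- This accounts for the index shift.
    P-minusOne : ∀ n → Motzkin.P q (- 1#) 1# (suc n) 0 ≈ D signed n 0
    P-minusOne n = begin
      Motzkin.P q (- 1#) 1# (suc n) 0             ≈⟨ P≈D-catalan q (- 1#) (suc n) 0 ⟩
      1# * D (catalanCoeff (- 1#) q) (suc (double n)) 1  ≈⟨ *-identityˡ _ ⟩
      D (catalanCoeff (- 1#) q) (suc (double n)) 1       ≈⟨ D-catalan-odd n 0 ⟩
      D signed n 0                                ∎

    -- The weights are `- q` times the powers of `q ^ 2`, which are the Carlitz coefficients at
    -- `q ^ 2`.
    D-signed-even : ∀ m → D signed (double m) 0 ≈ (- q) ^ m * Carlitz m (q ^ 2)
    D-signed-even = contFrac-scale (- q) λ j →
      *-congˡ (sym (trans (catalanCoeff-Carlitz (q ^ 2) j) (^-square-product q j)))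

    D-signed-odd : ∀ m → D signed (suc (double m)) 0 ≈ 0#
    D-signed-odd m = D-odd signed (suc (double m)) m 0 (ℕ.+-identityʳ _)

-- Summation over 321-avoiding permutations

module Sums {ℓ₁ ℓ₂} (R : CommutativeRing ℓ₁ ℓ₂) where

  open QCatalan R
  open Paths R
  open import Algebra.Properties.Semiring.Sum semiring using (sum; sum-syntax; sum-cong-≋)
  open import Algebra.Properties.Semiring.Exp semiring using (^-homo-*)
  open import Algebra.Properties.CommutativeSemigroup +-commutativeSemigroup using (x∙yz≈y∙xz)
  open import Algebra.Solver.Ring.NaturalCoefficients.Default commutativeSemiring
    using (solve; _:=_; _:+_; _:*_; con)
  open import Relation.Binary.Reasoning.Setoid setoid

  -- Finite sums

  if-does : ∀ {a} {A : Set a} (a? : Dec A) {x y : Carrier} →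
            (A → x ≈ y) → (¬ A → 0# ≈ y) → (if does a? then x else 0#) ≈ y
  if-does (yes a) x≈y 0≈y = x≈y a
  if-does (no ¬a) x≈y 0≈y = 0≈y ¬a

  module _ {a} {A : Set a} where

    ∑-cong : ∀ xs {f g : A → Carrier} → (∀ x → f x ≈ g x) → ∑ xs f ≈ ∑ xs g
    ∑-cong []       f≈g = refl
    ∑-cong (x ∷ xs) f≈g = +-cong (f≈g x) (∑-cong xs f≈g)

    ∑-0 : ∀ (xs : List A) → ∑ xs (λ _ → 0#) ≈ 0#
    ∑-0 []       = refl
    ∑-0 (x ∷ xs) = trans (+-identityˡ _) (∑-0 xs)

    ∑-* : ∀ b xs (f : A → Carrier) → ∑ xs (λ x → b * f x) ≈ b * ∑ xs f
    ∑-* b []       f = sym (zeroʳ b)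
    ∑-* b (x ∷ xs) f = trans (+-congˡ (∑-* b xs f)) (sym (distribˡ _ _ _))

    ∑-++ : ∀ xs ys (f : A → Carrier) → ∑ (xs ++ ys) f ≈ ∑ xs f + ∑ ys f
    ∑-++ []       ys f = sym (+-identityˡ _)
    ∑-++ (x ∷ xs) ys f = trans (+-congˡ (∑-++ xs ys f)) (sym (+-assoc _ _ _))

    ∑-↭ : ∀ {xs ys} (f : A → Carrier) → xs ↭ ys → ∑ xs f ≈ ∑ ys f
    ∑-↭ f ↭.refl         = refl
    ∑-↭ f (↭.prep x p)   = +-congˡ (∑-↭ f p)
    ∑-↭ f (↭.swap x y p) = trans (+-congˡ (+-congˡ (∑-↭ f p))) (x∙yz≈y∙xz _ _ _)
    ∑-↭ f (↭.trans p p′) = trans (∑-↭ f p) (∑-↭ f p′)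

    ∑-filter : ∀ {p} {P : Pred A p} (P? : Decidable P) xs (f : A → Carrier) →
               ∑ (filter P? xs) f ≈ ∑ xs (λ x → if does (P? x) then f x else 0#)
    ∑-filter P? []       f = refl
    ∑-filter P? (x ∷ xs) f with does (P? x)
    ... | true  = +-congˡ (∑-filter P? xs f)
    ... | false = trans (∑-filter P? xs f) (sym (+-identityˡ _))

    ∑-tabulate : ∀ {n} (g : Fin n → A) (f : A → Carrier) → ∑ (List.tabulate g) f ≈ ∑[ i < n ] f (g i)
    ∑-tabulate {zero}  g f = refl
    ∑-tabulate {suc n} g f = +-congˡ (∑-tabulate (g ∘ suc) f)

  ∑-map : ∀ {a b} {A : Set a} {B : Set b} (g : A → B) xs (f : B → Carrier) → ∑ (List.map g xs) f ≈ ∑ xs (f ∘ g)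
  ∑-map g []       f = refl
  ∑-map g (x ∷ xs) f = +-congˡ (∑-map g xs f)

  ∑-cartesianProductWith : ∀ {a b d} {A : Set a} {B : Set b} {D : Set d} (g : A → B → D) xs ys (f : D → Carrier) →
    ∑ (cartesianProductWith g xs ys) f ≈ ∑ xs (λ x → ∑ ys (f ∘ g x))
  ∑-cartesianProductWith g []       ys f = refl
  ∑-cartesianProductWith g (x ∷ xs) ys f = trans (∑-++ (List.map (g x) ys) _ f)
    (+-cong (∑-map (g x) ys f) (∑-cartesianProductWith g xs ys f))

  ∑-codes-suc : ∀ n (f : Code (suc n) → Carrier) →
    ∑ (codes (suc n)) f ≈ ∑[ v < suc n ] ∑ (codes n) (f ∘ (v ∷_))
  ∑-codes-suc n f = trans (∑-cartesianProductWith _∷_ (List.allFin (suc n)) (codes n) f)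
    (∑-tabulate {n = suc n} id (λ v → ∑ (codes n) (f ∘ (v ∷_))))

  -- Extending by zero to all codes removes the avoidance condition from the index set.
  ∑-𝔖321 : ∀ n {f : Word n → Carrier} {g : Code n → Carrier} →
    (∀ c → Admissible 0 (perm c) → f (decode c) ≈ g c) → (∀ c → ¬ Admissible 0 (perm c) → g c ≈ 0#) →
    ∑ (𝔖321 n) f ≈ ∑ (codes n) g
  ∑-𝔖321 n {f} {g} f≈g g≈0 = begin
    ∑ (𝔖321 n) f                                             ≈⟨ ∑-↭ f (𝔖321↭codes n) ⟩
    ∑ (filter avoids321? (List.map decode (codes n))) f      ≈⟨ ∑-filter avoids321? (List.map decode (codes n)) f ⟩
    ∑ (List.map decode (codes n)) f′                         ≈⟨ ∑-map decode (codes n) f′ ⟩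
    ∑ (codes n) (f′ ∘ decode)                                ≈⟨ ∑-cong (codes n) pointwise ⟩
    ∑ (codes n) g                                            ∎
    where
    f′ : Word n → Carrier
    f′ π = if does (avoids321? π) then f π else 0#
    pointwise : ∀ c → f′ (decode c) ≈ g c
    pointwise c = if-does (avoids321? (decode c))
      (f≈g c ∘ Equivalence.to (Avoids321⇔Admissible c))
      (λ ¬av → sym (g≈0 c (¬av ∘ Equivalence.from (Avoids321⇔Admissible c))))

  -- Sums over h ≤ v < N

  ∑≥ : ℕ → ℕ → (ℕ → Carrier) → Carrier
  ∑≥ zero    h       f = 0#
  ∑≥ (suc N) zero    f = f 0 + ∑≥ N 0 (f ∘ suc)
  ∑≥ (suc N) (suc h) f = ∑≥ N h (f ∘ suc)

  ∑≥-empty : ∀ N {h} f → N ≤ h → ∑≥ N h f ≈ 0#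
  ∑≥-empty zero    f _         = refl
  ∑≥-empty (suc N) f (s≤s N≤h) = ∑≥-empty N (f ∘ suc) N≤h

  ∑≥-step : ∀ {N h} f → h < N → ∑≥ N h f ≈ f h + ∑≥ N (suc h) f
  ∑≥-step {suc N} {zero}  f _         = refl
  ∑≥-step {suc N} {suc h} f (s≤s h<N) = ∑≥-step (f ∘ suc) h<N

  ∑≥-all : ∀ N f → ∑[ v < N ] f (toℕ v) ≈ ∑≥ N 0 f
  ∑≥-all zero    f = refl
  ∑≥-all (suc N) f = +-congˡ (∑≥-all N (f ∘ suc))

  -- h <? suc v decides h ≤ v by a Boolean that reduces on successors.
  ∑≥-if : ∀ N h f → ∑[ v < N ] (if does (h ℕ.<? suc (toℕ v)) then f (toℕ v) else 0#) ≈ ∑≥ N h f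
  ∑≥-if zero    h       f = refl
  ∑≥-if (suc N) zero    f = +-congˡ (∑≥-if N zero (f ∘ suc))
  ∑≥-if (suc N) (suc h) f = trans (+-identityˡ _) (∑≥-if N h (f ∘ suc))

  -- Weights of codes and their generating sums

  module Weights (q s x : Carrier) where

    open Motzkin q s x

    w : ℕ → Carrier
    w zero    = x
    w (suc v) = s * q ^ v

    W : ∀ {n} → ℕ → Code n → Carrier
    W h       []          = 1#
    W zero    (v ∷ c)     = w (toℕ v) * W (toℕ v) c
    W (suc h) (zero ∷ c)  = W h c
    W (suc h) (suc v ∷ c) = if does (h ℕ.<? suc (toℕ v)) then w (suc (toℕ v)) * W (suc (toℕ v)) c else 0#

    L : ℕ → ℕ → Carrier
    L n h = ∑ (codes n) (W h)

    L-zero : ∀ n → L (suc n) 0 ≈ ∑≥ (suc n) 0 (λ v → w v * L n v)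
    L-zero n = begin
      L (suc n) 0
        ≈⟨ ∑-codes-suc n (W 0) ⟩
      ∑[ v < suc n ] ∑ (codes n) (λ c → w (toℕ v) * W (toℕ v) c)
        ≈⟨ sum-cong-≋ (λ (v : Fin (suc n)) → ∑-* (w (toℕ v)) (codes n) (W (toℕ v))) ⟩
      ∑[ v < suc n ] (w (toℕ v) * L n (toℕ v))
        ≈⟨ ∑≥-all (suc n) (λ v → w v * L n v) ⟩
      ∑≥ (suc n) 0 (λ v → w v * L n v) ∎

    L-suc : ∀ n h → L (suc n) (suc h) ≈ L n h + ∑≥ n h (λ v → w (suc v) * L n (suc v))
    L-suc n h = trans (∑-codes-suc n (W (suc h))) (+-congˡ (trans
      (sum-cong-≋ pull) (∑≥-if n h (λ v → w (suc v) * L n (suc v)))))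
      where
      pull : (v : Fin n) → ∑ (codes n) (λ c → W (suc h) (suc v ∷ c))
             ≈ (if does (h ℕ.<? suc (toℕ v)) then w (suc (toℕ v)) * L n (suc (toℕ v)) else 0#)
      pull v with does (h ℕ.<? suc (toℕ v))
      ... | true  = ∑-* (w (suc (toℕ v))) (codes n) (W (suc (toℕ v)))
      ... | false = ∑-0 (codes n)

    L≈𝕊 : ∀ n m h → m ℕ.+ h ≡ n → L n h ≈ 𝕊 h (P m)
    -- The joint contribution of new maxima. Splitting off the smallest one leaves a sum of the same
    -- kind with `h` raised, and `𝕊-V-P` recombines the two.
    L-tail : ∀ n m h → m ℕ.+ h ≡ n → ∑≥ n h (λ v → w (suc v) * L n (suc v)) ≈ s * q ^ h * 𝕊 h (V (P m))

    L-tail n zero    h ≡.refl = trans (∑≥-empty h _ ℕ.≤-refl) (sym (trans (*-congˡ (𝕊-V-P₀ h)) (zeroʳ _)))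
    L-tail n (suc m) h eq     = begin
      ∑≥ n h g
        ≈⟨ ∑≥-step g (≡.subst (h <_) eq (s≤s (ℕ.m≤n+m h m))) ⟩
      s * q ^ h * L n (suc h) + ∑≥ n (suc h) g
        ≈⟨ +-cong (*-congˡ (L≈𝕊 n m (suc h) eq′)) (L-tail n m (suc h) eq′) ⟩
      s * q ^ h * 𝕊 (suc h) (P m) + s * q ^ suc h * 𝕊 (suc h) (V (P m))
        ≈⟨ solve 5 (λ s a q y z → (s :* a) :* y :+ (s :* (q :* a)) :* z := (s :* a) :* (y :+ q :* z)) refl
             s (q ^ h) q _ _ ⟩
      s * q ^ h * (𝕊 (suc h) (P m) + q * 𝕊 (suc h) (V (P m)))
        ≈⟨ *-congˡ (𝕊-V-P h m) ⟨
      s * q ^ h * 𝕊 h (V (P (suc m))) ∎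
      where
      g : ℕ → Carrier
      g v = w (suc v) * L n (suc v)
      eq′ : m ℕ.+ suc h ≡ n
      eq′ = ≡.trans (ℕ.+-suc m h) eq

    L≈𝕊 zero    zero    zero    _  = +-identityʳ _
    L≈𝕊 (suc n) (suc m) zero    eq
      with ≡.refl ← ≡.trans (≡.sym (ℕ.+-identityʳ m)) (ℕ.suc-injective eq) = begin
      L (suc n) 0
        ≈⟨ L-zero n ⟩
      x * L n 0 + ∑≥ n 0 (λ v → w (suc v) * L n (suc v))
        ≈⟨ +-cong (*-congˡ (L≈𝕊 n n 0 (ℕ.+-identityʳ n))) (L-tail n n 0 (ℕ.+-identityʳ n)) ⟩
      x * P n 0 + s * 1# * (1# * P n 1)
        ≈⟨ +-congˡ (*-cong (*-identityʳ s) (*-identityˡ _)) ⟩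
      P (suc n) 0 ∎
    L≈𝕊 (suc n) m       (suc h) eq = begin
      L (suc n) (suc h)                                        ≈⟨ L-suc n h ⟩
      L n h + ∑≥ n h (λ v → w (suc v) * L n (suc v))           ≈⟨ +-cong (L≈𝕊 n m h eq′) (L-tail n m h eq′) ⟩
      𝕊 h (P m) + s * q ^ h * 𝕊 h (V (P m))                    ≈⟨ 𝕊-suc h (P m) ⟨
      𝕊 (suc h) (P m)                                          ∎
      where eq′ = ℕ.suc-injective (≡.trans (≡.sym (ℕ.+-suc m h)) eq)

    weight : ℕ → ℕ → ℕ → Carrier
    weight fx ex iv = x ^ fx * (s ^ ex * q ^ (iv ∸ ex))

    -- The exponent of `q` grows by exactly `v`, as `ex ≤ iv` prevents truncation.
    weight-max : ∀ v fx ex iv → ex ≤ iv → w (suc v) * weight fx ex iv ≈ weight fx (suc ex) (suc v ℕ.+ iv)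
    weight-max v fx ex iv ex≤iv = begin
      s * q ^ v * (x ^ fx * (s ^ ex * q ^ (iv ∸ ex)))
        ≈⟨ solve 5 (λ s a b d e → (s :* a) :* (b :* (d :* e)) := b :* ((s :* d) :* (a :* e))) refl
             s (q ^ v) (x ^ fx) (s ^ ex) _ ⟩
      x ^ fx * (s * s ^ ex * (q ^ v * q ^ (iv ∸ ex)))
        ≈⟨ *-congˡ (*-congˡ (^-homo-* q v (iv ∸ ex))) ⟨
      x ^ fx * (s * s ^ ex * q ^ (v ℕ.+ (iv ∸ ex)))
        ≈⟨ *-congˡ (*-congˡ (reflexive (≡.cong (q ^_) (ℕ.+-∸-assoc v ex≤iv)))) ⟨
      x ^ fx * (s * s ^ ex * q ^ (v ℕ.+ iv ∸ ex)) ∎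

    W≈weight : ∀ {n h} (c : Code n) → Admissible h (perm c) →
               W h c ≈ weight (fix≥ h (perm c)) (exc≥ h (perm c)) (invᶠ (perm c))
    -- A legal first letter leaves a tail that is again not admissible; an illegal one has weight 0
    -- by definition.
    W≈0 : ∀ {n h} (c : Code n) → ¬ Admissible h (perm c) → W h c ≈ 0#

    -- The step for a nonzero first letter, shared by zero and positive thresholds.
    W-max≈weight : ∀ {n h} v (c : Code n) → Admissible h (perm (suc v ∷ c)) →
      w (suc (toℕ v)) * W (suc (toℕ v)) c
      ≈ weight (fix≥ h (perm (suc v ∷ c))) (exc≥ h (perm (suc v ∷ c))) (invᶠ (perm (suc v ∷ c)))
    W-max≈weight v c a
      rewrite exc-max c {v = v} (Admissible-first {c = c} a) (Admissible-max⁻ a)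
            | fix-max c {v = v} (Admissible-first {c = c} a) (Admissible-max⁻ a) | inv-∷ (suc v) c =
      trans (*-congˡ (W≈weight c (Admissible-max⁻ a)))
            (weight-max (toℕ v) (fix≥ (suc (toℕ v)) (perm c)) (exc≥ (suc (toℕ v)) (perm c)) (invᶠ (perm c))
              (exc≤inv c (Admissible-max⁻ a)))

    W≈weight []                      a = sym (trans (*-identityˡ _) (*-identityˡ _))
    W≈weight {h = zero}  (zero ∷ c)  a
      rewrite exc-fixed c (Admissible-max⁻ a) | fix-fixed c (Admissible-max⁻ a) | inv-∷ zero c =
      trans (*-congˡ (W≈weight c (Admissible-max⁻ a))) (sym (*-assoc _ _ _))
    W≈weight {h = zero}  (suc v ∷ c) a = W-max≈weight v c a
    W≈weight {h = suc h} (zero ∷ c)  a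
      rewrite exc-min c {h} | fix-min c {h} | inv-∷ zero c = W≈weight c (Admissible-min⁻ a)
    W≈weight {h = suc h} (suc v ∷ c) a = if-does (h ℕ.<? suc (toℕ v))
      (λ _ → W-max≈weight v c a)
      (λ h≰v → contradiction (Admissible-first {c = c} a) h≰v)

    W≈0 []                      ¬a = contradiction (record { avoids = λ () ; tops = λ () }) ¬a
    W≈0 {h = zero}  (v ∷ c)     ¬a = trans (*-congˡ (W≈0 c (λ a → ¬a (Admissible-max⁺ a z≤n)))) (zeroʳ _)
    W≈0 {h = suc h} (zero ∷ c)  ¬a = W≈0 c (¬a ∘ Admissible-min⁺)
    W≈0 {h = suc h} (suc v ∷ c) ¬a = if-does (h ℕ.<? suc (toℕ v))
      (λ h≤v → trans (*-congˡ (W≈0 c (λ a → ¬a (Admissible-max⁺ a h≤v)))) (zeroʳ _))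
      (λ _ → refl)

    ∑-𝔖321≈P : ∀ n {f : Word n → Carrier} →
      (∀ c → Admissible 0 (perm c) → f (decode c) ≈ weight (fix≥ 0 (perm c)) (exc≥ 0 (perm c)) (invᶠ (perm c))) →
      ∑ (𝔖321 n) f ≈ P n 0
    ∑-𝔖321≈P n f≈weight = trans
      (∑-𝔖321 n (λ c a → trans (f≈weight c a) (sym (W≈weight c a))) W≈0)
      (L≈𝕊 n n 0 (ℕ.+-identityʳ n))

  -- Specialisations at x = 1 and x = 0

  1^n≈1 : ∀ n → 1# ^ n ≈ 1#
  1^n≈1 zero    = refl
  1^n≈1 (suc n) = trans (*-identityˡ _) (1^n≈1 n)

  ^-* : ∀ a b n → (a * b) ^ n ≈ a ^ n * b ^ n
  ^-* a b zero    = sym (*-identityˡ _)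
  ^-* a b (suc n) = trans (*-congˡ (^-* a b n))
    (solve 4 (λ a b x y → (a :* b) :* (x :* y) := (a :* x) :* (b :* y)) refl a b (a ^ n) (b ^ n))

  ∑-𝔖321-excInv : ∀ q s n → ∑ (𝔖321 n) (λ π → s ^ exc π * q ^ (inv π ∸ exc π)) ≈ Motzkin.P q s 1# n 0
  ∑-𝔖321-excInv q s n = Weights.∑-𝔖321≈P q s 1# n λ c _ → begin
    s ^ exc (decode c) * q ^ (inv (decode c) ∸ exc (decode c))
      ≡⟨ ≡.cong₂ (λ e i → s ^ e * q ^ (i ∸ e)) (exc-decode c) (inv-decode c) ⟩
    s ^ exc≥ 0 (perm c) * q ^ (invᶠ (perm c) ∸ exc≥ 0 (perm c))
      ≈⟨ trans (*-congʳ (1^n≈1 (fix≥ 0 (perm c)))) (*-identityˡ _) ⟨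
    1# ^ fix≥ 0 (perm c) * (s ^ exc≥ 0 (perm c) * q ^ (invᶠ (perm c) ∸ exc≥ 0 (perm c))) ∎

  -- Setting `x = 0` discards permutations with a fixed point, and `s = t * q` turns the exponent
  -- inv - exc into inv.
  ∑-𝔇321-excInv : ∀ q t n → ∑ (𝔇321 n) (λ π → t ^ exc π * q ^ inv π) ≈ Motzkin.P q (t * q) 0# n 0
  ∑-𝔇321-excInv q t n = trans (∑-filter fixedPointFree? (𝔖321 n) _) (Weights.∑-𝔖321≈P q (t * q) 0# n pointwise)
    where
    open Weights q (t * q) 0# using (weight)
    pointwise : ∀ c → Admissible 0 (perm c) →
      (if does (fixedPointFree? (decode c)) then t ^ exc (decode c) * q ^ inv (decode c) else 0#)
      ≈ weight (fix≥ 0 (perm c)) (exc≥ 0 (perm c)) (invᶠ (perm c))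
    pointwise c a = if-does (fixedPointFree? (decode c)) free notFree
      where
      e i : ℕ
      e = exc≥ 0 (perm c)
      i = invᶠ (perm c)
      free : FixedPointFree (decode c) →
             t ^ exc (decode c) * q ^ inv (decode c) ≈ weight (fix≥ 0 (perm c)) e i
      -- Without fixed points the factor is `0# ^ 0`, which is `1#`. Since exc is at most inv,
      -- `q ^ e` splits off and joins `t ^ e`.
      free fpf rewrite Equivalence.to (fix-decode c) fpf | exc-decode c | inv-decode c = begin
        t ^ e * q ^ i                      ≡⟨ ≡.cong (λ k → t ^ e * q ^ k) (ℕ.m+[n∸m]≡n (exc≤inv c a)) ⟨
        t ^ e * q ^ (e ℕ.+ (i ∸ e))        ≈⟨ *-congˡ (^-homo-* q e (i ∸ e)) ⟩
        t ^ e * (q ^ e * q ^ (i ∸ e))      ≈⟨ *-assoc _ _ _ ⟨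
        t ^ e * q ^ e * q ^ (i ∸ e)        ≈⟨ *-congʳ (^-* t q e) ⟨
        (t * q) ^ e * q ^ (i ∸ e)          ≈⟨ *-identityˡ _ ⟨
        1# * ((t * q) ^ e * q ^ (i ∸ e))   ∎
      notFree : ¬ FixedPointFree (decode c) → 0# ≈ weight (fix≥ 0 (perm c)) e i
      notFree ¬fpf with fix≥ 0 (perm c) in eq
      ... | zero  = contradiction (Equivalence.from (fix-decode c) eq) ¬fpf
      ... | suc k = sym (trans (*-congʳ (zeroˡ _)) (zeroˡ _))

-- The two signed identities by parity

theorem1p4 : ∀ {c ℓ} (R : CommutativeRing c ℓ) → let open QCatalan R in
    (q : Carrier) (n : ℕ) → 1 ≤ n →
    (C n (- 1#) q ≈ ∑ (𝔖321 n) (λ π → (- 1#) ^ exc π * q ^ (inv π ∸ exc π)))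
    × (2 ∣ n → ∑ (𝔖321 n) (λ π → (- 1#) ^ exc π * q ^ (inv π ∸ exc π)) ≈ 0#)
    × (¬ 2 ∣ n → ∑ (𝔖321 n) (λ π → (- 1#) ^ exc π * q ^ (inv π ∸ exc π))
    ≈ (- q) ^ ((n ∸ 1) / 2) * Carlitz ((n ∸ 1) / 2) (q ^ 2))
    × (2 ∣ n → ∑ (𝔇321 n) (λ π → (- 1#) ^ exc π * q ^ inv π)
    ≈ (- q) ^ (n / 2) * Carlitz (n / 2) (q ^ 2))
    × (¬ 2 ∣ n → ∑ (𝔇321 n) (λ π → (- 1#) ^ exc π * q ^ inv π) ≈ 0#)
theorem1p4 R q (suc n) _ =
  trans (C≈P q (- 1#) (suc n)) (sym (∑-𝔖321-excInv q (- 1#) (suc n))) ,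
  𝔖-even , 𝔖-odd , 𝔇-even , 𝔇-odd
  where
  open QCatalan R
  open Paths R
  open Sums R
  open import Algebra.Properties.Ring ring using (-1*x≈-x)

  -- The permutations have size `suc n` but the paths have `n` steps, so here the even sizes vanish,
  -- in contrast to `𝔇`.
  𝔖 : ∑ (𝔖321 (suc n)) (λ π → (- 1#) ^ exc π * q ^ (inv π ∸ exc π)) ≈ D (signed q) n 0
  𝔖 = trans (∑-𝔖321-excInv q (- 1#) (suc n)) (P-minusOne q n)

  𝔇 : ∀ n → ∑ (𝔇321 n) (λ π → (- 1#) ^ exc π * q ^ inv π) ≈ D (signed q) n 0
  𝔇 n = trans (∑-𝔇321-excInv q (- 1#) n) (P-derangement q (-1*x≈-x q) n 0)

  D-even : ∀ k → 2 ∣ k → D (signed q) k 0 ≈ (- q) ^ (k / 2) * Carlitz (k / 2) (q ^ 2)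
  D-even k 2∣k with parity k
  ... | even m rewrite double/2 m = D-signed-even q m
  ... | odd m  = contradiction 2∣k (2∤1+double m)

  D-odd′ : ∀ k → ¬ 2 ∣ k → D (signed q) k 0 ≈ 0#
  D-odd′ k 2∤k with parity k
  ... | even m = contradiction (2∣double m) 2∤k
  ... | odd m  = D-signed-odd q m

  𝔖-even : 2 ∣ suc n → _ ≈ 0#
  𝔖-even 2∣1+n = trans 𝔖 (D-odd′ n (λ 2∣n → 2∤both n 2∣n 2∣1+n))
    where
    2∤both : ∀ n → 2 ∣ n → ¬ 2 ∣ suc n
    2∤both n 2∣n 2∣1+n with parity n
    ... | even m = 2∤1+double m 2∣1+n
    ... | odd m  = 2∤1+double m 2∣n

  𝔖-odd : ¬ 2 ∣ suc n → _ ≈ (- q) ^ (n / 2) * Carlitz (n / 2) (q ^ 2)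
  𝔖-odd 2∤1+n = trans 𝔖 (D-even n (2∣one n 2∤1+n))
    where
    2∣one : ∀ n → ¬ 2 ∣ suc n → 2 ∣ n
    2∣one n 2∤1+n with parity n
    ... | even m = 2∣double m
    ... | odd m  = contradiction (2∣double (suc m)) 2∤1+n

  𝔇-even : 2 ∣ suc n → _ ≈ (- q) ^ (suc n / 2) * Carlitz (suc n / 2) (q ^ 2)
  𝔇-even 2∣1+n = trans (𝔇 (suc n)) (D-even (suc n) 2∣1+n)

  𝔇-odd : ¬ 2 ∣ suc n → _ ≈ 0#
  𝔇-odd 2∤1+n = trans (𝔇 (suc n)) (D-odd′ (suc n) 2∤1+n)
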